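{- For any $u\in\mathfrak{S}_p$ and $v\in\mathfrak{S}_q$, in $\mathfrak{S}\mathit{Sym}$ \[\mathcal{M}_u\cdot\mathcal{M}_v=\sum_{w\in\mathfrak{S}_{p+q}}\alpha^w_{u,v}\,\mathcal{M}_w,\] where $\alpha^w_{u,v}$ is the number of $\zeta\in\mathfrak{S}^{(p,q)}$ such that (i) $(u\times v)\zeta^{ -1}\leq w$, and (ii) whenever $u'\in\mathfrak{S}_p$, $v'\in\mathfrak{S}_q$ with $u\leq u'$, $v\leq v'$ satisfy $(u'\times v')\zeta^{ -1}\leq w$, then $u'=u$ and $v'=v$. (Equivalently, $(u,v)$ is the maximum of $\rho_\zeta^{ -1}([1,w])$, where $\rho_\zeta(u,v)=(u\times v)\zeta^{ -1}$ and $[1,w]$ is the interval below $w$ in the weak order.)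
   Context: For $n\geq0$, $\mathfrak{S}_n$ is the symmetric group on $[n]$ ($\mathfrak{S}_0$ has one element); $u$ is written as the word $u_1\cdots u_n$, $u_i=u(i)$; permutations multiply as functions, $(uv)(i)=u(v(i))$. $\ell(u)=\#\{i<j\mid u_i>u_j\}$; the weak order on $\mathfrak{S}_n$: $u\leq v$ iff $v=wu$ for some $w$ with $\ell(v)=\ell(w)+\ell(u)$; on $\mathfrak{S}_p\times\mathfrak{S}_q$ use the product order. For distinct integers $a_1,\dots,a_p$, $\mathrm{st}(a_1,\dots,a_p)\in\mathfrak{S}_p$ is the permutation $u$ with $u_i<u_j\iff a_i<a_j$. For $u\in\mathfrak{S}_p,v\in\mathfrak{S}_q$, $u\times v\in\mathfrak{S}_{p+q}$ has word $u_1\cdots u_p(v_1+p)\cdots(v_q+p)$; $\mathfrak{S}^{(p,q)}$ is the set of $\zeta\in\mathfrak{S}_{p+q}$ having no descent except possibly at position $p$ (Grassmannian permutations). $\mathfrak{S}\mathit{Sym}$ is the graded $\mathbb{Q}$-vector space with basis $\{\mathcal{F}_u\mid u\in\mathfrak{S}_n,n\geq0\}$, with product $\mathcal{F}_u\cdot\mathcal{F}_v=\sum_{\zeta\in\mathfrak{S}^{(p,q)}}\mathcal{F}_{(u\times v)\zeta^{ -1}}$ for $u\in\mathfrak{S}_p,v\in\mathfrak{S}_q$, and coproduct $\Delta(\mathcal{F}_u)=\sum_{p=0}^n\mathcal{F}_{\mathrm{st}(u_1,\dots,u_p)}\otimes\mathcal{F}_{\mathrm{st}(u_{p+1},\dots,u_n)}$;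 it is a graded connected Hopf algebra (Malvenuto–Reutenauer). The monomial basis is $\mathcal{M}_u=\sum_{v\geq u}\mu_{\mathfrak{S}_n}(u,v)\mathcal{F}_v$, with $\mu_{\mathfrak{S}_n}$ the Möbius function of the weak order; equivalently $\mathcal{F}_u=\sum_{v\geq u}\mathcal{M}_v$. -}

module Defs where

open import Data.Bool using (Bool; true; false; _∧_; _∨_; not; if_then_else_; T)
open import Data.Nat using (ℕ; zero; suc; _+_; _∸_; _≤_; _<ᵇ_; _≡ᵇ_)
open import Data.List using (List; []; _∷_; _++_; map; concatMap; length; foldr; applyUpTo)
open import Data.List.Relation.Unary.All using (All)
open import Data.List.Relation.Unary.Unique.Propositional using (Unique)
open import Data.Product using (_×_; _,_)
open import Data.Rational using (ℚ; 0ℚ; 1ℚ; -_; _*_)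
import Data.Rational as ℚ
open import Relation.Binary.PropositionalEquality using (_≡_)

-- Permutations of [n] = {1,…,n} are represented by their words
-- u₁ ⋯ uₙ, as lists of natural numbers.

Word : Set
Word = List ℕ

IsPerm : ℕ → Word → Set
IsPerm n w = (length w ≡ n) × All (λ a → 1 ≤ a × a ≤ n) w × Unique w

filterB : {A : Set} → (A → Bool) → List A → List A
filterB p []       = []
filterB p (x ∷ xs) = if p x then x ∷ filterB p xs else filterB p xs

anyB : {A : Set} → (A → Bool) → List A → Bool
anyB p []       = false
anyB p (x ∷ xs) = p x ∨ anyB p xs

allB : {A : Set} → (A → Bool) → List A → Bool
allB p []       = true
allB p (x ∷ xs) = p x ∧ allB p xs

eqW : Word → Word → Bool
eqW []       []       = true
eqW (x ∷ xs) (y ∷ ys) = (x ≡ᵇ y) ∧ eqW xs ys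
eqW _        _        = false

range : ℕ → List ℕ
range n = applyUpTo suc n

distinctB : Word → Bool
distinctB []       = true
distinctB (x ∷ xs) = not (anyB (λ y → x ≡ᵇ y) xs) ∧ distinctB xs

wordsOf : ℕ → ℕ → List Word
wordsOf n zero    = [] ∷ []
wordsOf n (suc k) = concatMap (λ a → map (a ∷_) (wordsOf n k)) (range n)

perms : ℕ → List Word
perms n = filterB distinctB (wordsOf n n)

-- u(i), 1-based (0 outside the range)
at0 : Word → ℕ → ℕ
at0 []       _       = 0
at0 (x ∷ xs) zero    = x
at0 (x ∷ xs) (suc i) = at0 xs i

at : Word → ℕ → ℕ
at u zero    = 0
at u (suc i) = at0 u i

pos : ℕ → Word → ℕ
pos a []       = 0
pos a (x ∷ xs) = if a ≡ᵇ x then 1 else suc (pos a xs)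

compose : Word → Word → Word
compose u v = map (at u) v

inverse : Word → Word
inverse u = map (λ i → pos i u) (range (length u))

len : Word → ℕ
len []       = 0
len (x ∷ xs) = length (filterB (λ y → y <ᵇ x) xs) + len xs

weakLeq : Word → Word → Bool
weakLeq u v = anyB (λ w → eqW v (compose w u) ∧ (len v ≡ᵇ (len w + len u)))
                   (perms (length u))

cross : Word → Word → Word
cross u v = u ++ map (λ b → b + length u) v

grassmannian : ℕ → ℕ → List Word
grassmannian p q =
  filterB (λ ζ → allB (λ i → (i ≡ᵇ p) ∨ (at ζ i <ᵇ at ζ (suc i))) (range (p + q ∸ 1))) (perms (p + q))

-- Möbius function of the weak order on 𝔖ₙ:
--   μ(u,u) = 1,  μ(u,v) = - Σ_{u ≤ z < v} μ(u,z)  for u < v,  μ(u,v) = 0 otherwise.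
-- Computed by recursion with fuel; fuel ℓ(v)+1 suffices since z < v ⇒ ℓ(z) < ℓ(v).

sumℚ : List ℚ → ℚ
sumℚ = foldr ℚ._+_ 0ℚ

mobiusFuel : ℕ → Word → Word → ℚ
mobiusFuel zero    u v = 0ℚ
mobiusFuel (suc f) u v =
  if eqW u v then 1ℚ
  else if weakLeq u v
    then - sumℚ (map (mobiusFuel f u)
                  (filterB (λ z → weakLeq u z ∧ weakLeq z v ∧ not (eqW z v))
                           (perms (length u))))
    else 0ℚ

mobius : Word → Word → ℚ
mobius u v = mobiusFuel (suc (len v)) u v

-- Elements of 𝔖Sym: finite ℚ-linear combinations of the basis 𝓕,
-- given as lists of (coefficient, index permutation).

SSym : Set
SSym = List (ℚ × Word)

coeff : SSym → Word → ℚ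
coeff x w = sumℚ (map (λ { (a , y) → if eqW y w then a else 0ℚ }) x)

_≈_ : SSym → SSym → Set
x ≈ y = (w : Word) → coeff x w ≡ coeff y w

F : Word → SSym
F u = (1ℚ , u) ∷ []

_•_ : ℚ → SSym → SSym
c • x = map (λ { (a , y) → (c * a , y) }) x

sumS : List SSym → SSym
sumS = foldr _++_ []

prodF : Word → Word → SSym
prodF u v = map (λ ζ → (1ℚ , compose (cross u v) (inverse ζ)))
                (grassmannian (length u) (length v))

_·_ : SSym → SSym → SSym
x · y = sumS (concatMap (λ { (a , u) → map (λ { (b , v) → (a * b) • prodF u v }) y }) x)

M : Word → SSym
M u = map (λ v → (mobius u v , v)) (filterB (weakLeq u) (perms (length u)))

countB : {A : Set} → (A → Bool) → List A → ℕ
countB p xs = length (filterB p xs)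

alpha : Word → Word → Word → ℕ
alpha u v w = countB cond (grassmannian p q)
  where
  p = length u
  q = length v
  rho : Word → Word → Word → Word
  rho ζ u' v' = compose (cross u' v') (inverse ζ)
  cond : Word → Bool
  cond ζ = weakLeq (rho ζ u v) w
         ∧ allB (λ u' → allB (λ v' →
               not (weakLeq u u' ∧ weakLeq v v' ∧ weakLeq (rho ζ u' v') w)
               ∨ (eqW u' u ∧ eqW v' v)) (perms q)) (perms p)

open import Data.Integer using (+_)
ℕtoℚ : ℕ → ℚ
ℕtoℚ n = (+ n) ℚ./ 1

{-# OPTIONS --safe #-}

-- For w in 𝔖ₙ let S_w : 𝔖Sym → ℚ sum the coefficients of the 𝓕_y with y ≤ w. By triangularity an element
-- of degree n is determined by its values under all S_w, and S_w(𝓜_y) = [y = w]; so it suffices to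
-- show S_w(𝓜_u · 𝓜_v) = α^w_{u,v}. Expanding the product, S_w(𝓜_u · 𝓜_v) is the sum over ζ of
-- Σ μ(u,u′) μ(v,v′) [ρ_ζ(u′,v′) ≤ w]. As u ≤ v in the weak order means that every inversion of u, as a
-- pair of positions, is an inversion of v, the set {(u′,v′) | ρ_ζ(u′,v′) ≤ w} is either empty or
-- the product of the intervals below a and b, where a and b are the standardizations of the subwords of w at the
-- positions occupied by u and by v. Hence the ζ-summand is 1 if the set is nonempty and (u,v) = (a,b),
-- and 0 otherwise.

module Submission where

open import Defs
open import Algebra.Bundles using (CommutativeRing)
import Algebra.Properties.CommutativeSemigroup as CommutativeSemigroup
open import Algebra.Properties.Group using (∙-cancelʳ)
open import Data.Bool using (Bool; true; false; _∧_; _∨_; not; if_then_else_; T)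
open import Data.Bool.Properties using (T-≡; T-∧; T-∨; ∧-comm; ∧-assoc; ∧-zeroʳ; T?)
open import Data.Empty using (⊥-elim)
import Data.Integer as ℤ
import Data.Integer.Properties as ℤ
open import Data.List using (List; []; _∷_; _++_; map; concatMap; length; applyUpTo; upTo)
open import Data.List.Membership.Propositional using (_∈_; _∉_; find; lose)
import Data.List.Membership.DecPropositional as DecMembership
open import Data.List.Membership.Propositional.Properties
  using (∈-++⁺ˡ; ∈-++⁺ʳ; ∈-++⁻; ∈-∃++; ∈-concat⁻′; ∈-concatMap⁺; ∈-concatMap⁻;
         ∈-map⁺; ∈-map⁻; ∈-applyUpTo⁺; ∈-applyUpTo⁻)
open import Data.List.Properties
  using (length-applyUpTo; length-map; map-applyUpTo; map-cong; map-cong-local; map-id; map-upTo; map-∘; ≡-dec)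
open import Data.List.Relation.Binary.Permutation.Propositional
  using (_↭_; prep; ↭-refl; ↭-reflexive; ↭-sym; ↭-trans; ↭⇒↭ₛ)
open import Data.List.Relation.Binary.Permutation.Propositional.Properties
  using (++⁺; shift; ↭-length; ∈-resp-↭) renaming (map⁺ to ↭-map⁺)
import Data.List.Relation.Binary.Permutation.Setoid.Properties as Permutation
open import Data.List.Relation.Unary.All as All using (All; []; _∷_)
import Data.List.Relation.Unary.All.Properties as All
open import Data.List.Relation.Unary.AllPairs as AllPairs using ([]; _∷_)
import Data.List.Relation.Unary.AllPairs.Properties as AllPairs
open import Data.List.Relation.Unary.Any using (here; there)
open import Data.List.Relation.Unary.Unique.Propositional using (Unique)
import Data.List.Relation.Unary.Unique.Propositional.Properties as Unique
open import Data.Nat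
open import Data.Nat.ListAction using (sum)
open import Data.Nat.ListAction.Properties using (sum-↭)
open import Data.Nat.Properties
open import Data.Product using (_×_; _,_; proj₁; proj₂; ∃)
open import Data.Rational as ℚ using (ℚ; 0ℚ; 1ℚ)
import Data.Rational.Properties as ℚ
import Data.Rational.Unnormalised as ℚᵘ
import Data.Rational.Unnormalised.Properties as ℚᵘ
open import Data.Sum using (_⊎_; inj₁; inj₂)
open import Data.Unit using (tt)
open import Function using (_∘_; _⇔_; mk⇔; Equivalence; case_of_)
open import Relation.Binary using (tri<; tri≈; tri>)
open import Relation.Binary.PropositionalEquality
open import Relation.Nullary using (¬_; Dec; yes; no; contradiction)

open Equivalence using (to; from)

-- `weakLeq` asks for a left factor w with additive length, a form in which the conditions on u′ and
-- on v′ do not separate. Hence the passage to inversion sets, which rests on counting the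
-- inversions gained and lost between u and wu. The pairs of positions in ρ_ζ(u′,v′) are of three
-- kinds. Two positions of u′ are compared by u′ alone, and two of v′ by v′ alone; their order is
-- kept because ζ increases on each block. In a mixed pair the letter from u′ is always the smaller
-- one, so ζ alone decides whether the pair is inverted. The mixed pairs therefore govern emptiness,
-- while the others give two independent conditions, one on u′ and one on v′. This lets the double
-- Möbius sum factor into two sums, each a Kronecker delta. That length grows strictly along the
-- weak order serves twice: the fuel of `mobius` suffices, and triangularity becomes an induction on
-- length.

module +-CS = CommutativeSemigroup +-commutativeSemigroup
module ℚ-+ = CommutativeSemigroup (CommutativeRing.+-commutativeSemigroup ℚ.+-*-commutativeRing)
module ℚ-* = CommutativeSemigroup (CommutativeRing.*-commutativeSemigroup ℚ.+-*-commutativeRing)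

-- Boolean predicates

T-ext : ∀ {a b} → (T a → T b) → (T b → T a) → a ≡ b
T-ext {false} {false} f g = refl
T-ext {false} {true}  f g = ⊥-elim (g tt)
T-ext {true}  {false} f g = ⊥-elim (f tt)
T-ext {true}  {true}  f g = refl

T⇒≡true : ∀ {b} → T b → b ≡ true
T⇒≡true = to T-≡

¬T⇒≡false : ∀ {b} → ¬ T b → b ≡ false
¬T⇒≡false {false} _ = refl
¬T⇒≡false {true}  f = ⊥-elim (f tt)

module _ {A : Set} {p : A → Bool} where

  ∈-filterB⁺ : ∀ {xs x} → x ∈ xs → T (p x) → x ∈ filterB p xs
  ∈-filterB⁺ {y ∷ xs} (here refl) px with true ← p y = here refl
  ∈-filterB⁺ {y ∷ xs} (there x∈)  px with p y
  ... | true  = there (∈-filterB⁺ x∈ px)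
  ... | false = ∈-filterB⁺ x∈ px

  ∈-filterB⁻ : ∀ {xs x} → x ∈ filterB p xs → x ∈ xs × T (p x)
  ∈-filterB⁻ {y ∷ xs} x∈ with p y in eq
  ∈-filterB⁻ {y ∷ xs} (here refl) | true  = here refl , from T-≡ eq
  ∈-filterB⁻ {y ∷ xs} (there x∈)  | true  = let x∈xs , px = ∈-filterB⁻ x∈ in there x∈xs , px
  ∈-filterB⁻ {y ∷ xs} x∈          | false = let x∈xs , px = ∈-filterB⁻ x∈ in there x∈xs , px

  Unique-filterB : ∀ {xs} → Unique xs → Unique (filterB p xs)
  Unique-filterB {[]}     []         = []
  Unique-filterB {x ∷ xs} (x≢ ∷ uxs) with p x
  ... | true  = All.tabulate (All.lookup x≢ ∘ proj₁ ∘ ∈-filterB⁻) ∷ Unique-filterB uxs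
  ... | false = Unique-filterB uxs

  T-anyB⁺ : ∀ {xs x} → x ∈ xs → T (p x) → T (anyB p xs)
  T-anyB⁺ {y ∷ xs} (here refl) px = from (T-∨ {p y}) (inj₁ px)
  T-anyB⁺ {y ∷ xs} (there x∈)  px = from (T-∨ {p y}) (inj₂ (T-anyB⁺ x∈ px))

  T-anyB⁻ : ∀ {xs} → T (anyB p xs) → ∃ λ x → x ∈ xs × T (p x)
  T-anyB⁻ {x ∷ xs} h with to (T-∨ {p x}) h
  ... | inj₁ px = x , here refl , px
  ... | inj₂ h′ = let y , y∈ , py = T-anyB⁻ h′ in y , there y∈ , py

  T-allB⁺ : ∀ {xs} → (∀ {x} → x ∈ xs → T (p x)) → T (allB p xs)
  T-allB⁺ {[]}     f = tt
  T-allB⁺ {x ∷ xs} f = from T-∧ (f (here refl) , T-allB⁺ (f ∘ there))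

  T-allB⁻ : ∀ {xs x} → T (allB p xs) → x ∈ xs → T (p x)
  T-allB⁻ h (here refl) = proj₁ (to T-∧ h)
  T-allB⁻ h (there x∈)  = T-allB⁻ (proj₂ (to T-∧ h)) x∈

-- Finite sums

∑ : {A : Set} → List A → (A → ℚ) → ℚ
∑ xs f = sumℚ (map f xs)

⟦_⟧ : Bool → ℚ
⟦ b ⟧ = if b then 1ℚ else 0ℚ

⟦⟧-∧ : ∀ a b → ⟦ a ∧ b ⟧ ≡ ⟦ a ⟧ ℚ.* ⟦ b ⟧
⟦⟧-∧ true  b = sym (ℚ.*-identityˡ ⟦ b ⟧)
⟦⟧-∧ false b = sym (ℚ.*-zeroˡ ⟦ b ⟧)

-- The division in `ℕtoℚ` reduces to lowest terms and does not compute for a variable n, hence the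
-- detour through unnormalised fractions.
ℕtoℚ-suc : ∀ n → ℕtoℚ (suc n) ≡ 1ℚ ℚ.+ ℕtoℚ n
ℕtoℚ-suc n = ℚ.toℚᵘ-injective (begin
  ℚ.toℚᵘ (ℕtoℚ (suc n))             ≈⟨ ℚ.toℚᵘ-fromℚᵘ (ℚᵘ.mkℚᵘ (ℤ.+ suc n) 0) ⟩
  ℚᵘ.mkℚᵘ (ℤ.+ suc n) 0             ≈⟨ ℚᵘ.*≡* (cong (ℤ._* ℤ.1ℤ) (sym (cong (ℤ._+_ ℤ.1ℤ) (ℤ.*-identityʳ (ℤ.+ n))))) ⟩
  ℚᵘ.1ℚᵘ ℚᵘ.+ ℚᵘ.mkℚᵘ (ℤ.+ n) 0     ≈⟨ ℚᵘ.+-congʳ ℚᵘ.1ℚᵘ (ℚ.toℚᵘ-fromℚᵘ (ℚᵘ.mkℚᵘ (ℤ.+ n) 0)) ⟨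
  ℚᵘ.1ℚᵘ ℚᵘ.+ ℚ.toℚᵘ (ℕtoℚ n)       ≈⟨ ℚ.toℚᵘ-homo-+ 1ℚ (ℕtoℚ n) ⟨
  ℚ.toℚᵘ (1ℚ ℚ.+ ℕtoℚ n)            ∎)
  where
  import Data.Rational.Unnormalised.Properties as ℚᵘ
  open ℚᵘ.≃-Reasoning

module _ {A : Set} where

  ∑-cong : ∀ xs {f g : A → ℚ} → (∀ {x} → x ∈ xs → f x ≡ g x) → ∑ xs f ≡ ∑ xs g
  ∑-cong []       f≗g = refl
  ∑-cong (x ∷ xs) f≗g = cong₂ ℚ._+_ (f≗g (here refl)) (∑-cong xs (f≗g ∘ there))

  ∑-0 : (xs : List A) → ∑ xs (λ _ → 0ℚ) ≡ 0ℚ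
  ∑-0 []       = refl
  ∑-0 (x ∷ xs) = trans (ℚ.+-identityˡ _) (∑-0 xs)

  ∑-zero : ∀ xs {f : A → ℚ} → (∀ {x} → x ∈ xs → f x ≡ 0ℚ) → ∑ xs f ≡ 0ℚ
  ∑-zero xs f≡0 = trans (∑-cong xs f≡0) (∑-0 xs)

  ∑-+ : ∀ xs (f g : A → ℚ) → ∑ xs (λ x → f x ℚ.+ g x) ≡ ∑ xs f ℚ.+ ∑ xs g
  ∑-+ []       f g = refl
  ∑-+ (x ∷ xs) f g = trans (cong ((f x ℚ.+ g x) ℚ.+_) (∑-+ xs f g)) (ℚ-+.interchange (f x) (g x) _ _)

  ∑-*ˡ : ∀ c xs (f : A → ℚ) → ∑ xs (λ x → c ℚ.* f x) ≡ c ℚ.* ∑ xs f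
  ∑-*ˡ c []       f = sym (ℚ.*-zeroʳ c)
  ∑-*ˡ c (x ∷ xs) f = trans (cong (c ℚ.* f x ℚ.+_) (∑-*ˡ c xs f)) (sym (ℚ.*-distribˡ-+ c (f x) (∑ xs f)))

  ∑-*ʳ : ∀ c xs (f : A → ℚ) → ∑ xs (λ x → f x ℚ.* c) ≡ ∑ xs f ℚ.* c
  ∑-*ʳ c xs f = trans (∑-cong xs (λ {x} _ → ℚ.*-comm (f x) c)) (trans (∑-*ˡ c xs f) (ℚ.*-comm c _))

  ∑-++ : ∀ xs ys (f : A → ℚ) → ∑ (xs ++ ys) f ≡ ∑ xs f ℚ.+ ∑ ys f
  ∑-++ []       ys f = sym (ℚ.+-identityˡ _)
  ∑-++ (x ∷ xs) ys f = trans (cong (f x ℚ.+_) (∑-++ xs ys f)) (sym (ℚ.+-assoc (f x) _ _))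

  ∑-filterB : ∀ (p : A → Bool) xs (f : A → ℚ) → ∑ (filterB p xs) f ≡ ∑ xs (λ x → ⟦ p x ⟧ ℚ.* f x)
  ∑-filterB p []       f = refl
  ∑-filterB p (x ∷ xs) f with p x
  ... | true  = cong₂ ℚ._+_ (sym (ℚ.*-identityˡ (f x))) (∑-filterB p xs f)
  ... | false = trans (∑-filterB p xs f)
                  (trans (sym (ℚ.+-identityˡ _)) (cong (ℚ._+ _) (sym (ℚ.*-zeroˡ (f x)))))

  ∑-countB : ∀ (p : A → Bool) xs → ∑ xs (λ x → ⟦ p x ⟧) ≡ ℕtoℚ (countB p xs)
  ∑-countB p []       = refl
  ∑-countB p (x ∷ xs) with p x
  ... | true  = trans (cong (1ℚ ℚ.+_) (∑-countB p xs)) (sym (ℕtoℚ-suc (countB p xs)))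
  ... | false = trans (ℚ.+-identityˡ _) (∑-countB p xs)

∑-map : ∀ {A B : Set} (h : A → B) xs (f : B → ℚ) → ∑ (map h xs) f ≡ ∑ xs (f ∘ h)
∑-map h []       f = refl
∑-map h (x ∷ xs) f = cong (f (h x) ℚ.+_) (∑-map h xs f)

∑-concatMap : ∀ {A B : Set} (h : A → List B) xs (f : B → ℚ) → ∑ (concatMap h xs) f ≡ ∑ xs (λ x → ∑ (h x) f)
∑-concatMap h []       f = refl
∑-concatMap h (x ∷ xs) f = trans (∑-++ (h x) (concatMap h xs) f) (cong (∑ (h x) f ℚ.+_) (∑-concatMap h xs f))

∑-swap : ∀ {A B : Set} xs ys (f : A → B → ℚ) → ∑ xs (λ x → ∑ ys (f x)) ≡ ∑ ys (λ y → ∑ xs (λ x → f x y))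
∑-swap []       ys f = sym (∑-0 ys)
∑-swap (x ∷ xs) ys f = trans (cong (∑ ys (f x) ℚ.+_) (∑-swap xs ys f)) (sym (∑-+ ys (f x) _))

-- Lists without repetition

Unique-resp-↭ : {A : Set} {xs ys : List A} → xs ↭ ys → Unique xs → Unique ys
Unique-resp-↭ {A} xs↭ys = Permutation.Unique-resp-↭ (setoid A) (↭⇒↭ₛ xs↭ys)

-- Pigeonhole: take the head x out of ys; since x does not recur in xs, the tail still lies in what
-- remains.
Unique-⊆-↭ : {A : Set} {xs ys : List A} → Unique xs → (∀ {x} → x ∈ xs → x ∈ ys) →
             length xs ≡ length ys → xs ↭ ys
Unique-⊆-↭ {xs = []}     {[]} _          _  _  = ↭-refl
Unique-⊆-↭ {xs = x ∷ xs} (x≢ ∷ uxs) ⊆ys ≡len with as , bs , refl ← ∈-∃++ (⊆ys (here refl)) =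
  ↭-trans (prep x (Unique-⊆-↭ uxs ⊆′ (suc-injective (trans ≡len (↭-length (shift x as bs)))))) (↭-sym (shift x as bs))
  where
  ⊆′ : ∀ {y} → y ∈ xs → y ∈ as ++ bs
  ⊆′ y∈ with ∈-resp-↭ (shift x as bs) (⊆ys (there y∈))
  ... | here refl = contradiction refl (All.lookup x≢ y∈)
  ... | there y∈′ = y∈′

-- Words and permutations

T-eqW : ∀ {u v} → T (eqW u v) ⇔ u ≡ v
T-eqW {u} {v} = mk⇔ (sound u v) λ { refl → complete u }
  where
  sound : ∀ u v → T (eqW u v) → u ≡ v
  sound []      []      _ = refl
  sound (x ∷ u) (y ∷ v) h = let x≡y , u≡v = to T-∧ h in cong₂ _∷_ (≡ᵇ⇒≡ x y x≡y) (sound u v u≡v)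
  complete : ∀ u → T (eqW u u)
  complete []      = tt
  complete (x ∷ u) = from T-∧ (≡⇒≡ᵇ x x refl , complete u)

∈-range : ∀ {n i} → i ∈ range n ⇔ (1 ≤ i × i ≤ n)
∈-range = mk⇔ bounds λ { (s≤s _ , i≤n) → ∈-applyUpTo⁺ suc i≤n }
  where
  bounds : ∀ {n i} → i ∈ range n → 1 ≤ i × i ≤ n
  bounds i∈ with _ , k<n , refl ← ∈-applyUpTo⁻ suc i∈ = s≤s z≤n , k<n

length-range : ∀ n → length (range n) ≡ n
length-range = length-applyUpTo suc

Unique-range : ∀ n → Unique (range n)
Unique-range n = Unique.applyUpTo⁺₁ suc n λ i<j _ → <⇒≢ (s<s i<j)

T-distinctB : ∀ {w} → T (distinctB w) ⇔ Unique w
T-distinctB = mk⇔ sound complete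
  where
  sound : ∀ {w} → T (distinctB w) → Unique w
  sound {[]}    _ = []
  sound {x ∷ w} h = All.tabulate (λ {y} y∈ x≡y → absurd _ (proj₁ (to T-∧ h)) (T-anyB⁺ y∈ (≡⇒≡ᵇ x y x≡y)))
                    ∷ sound (proj₂ (to T-∧ h))
    where
    absurd : ∀ b → T (not b) → ¬ T b
    absurd true ()
  complete : ∀ {w} → Unique w → T (distinctB w)
  complete []                = tt
  complete {x ∷ w} (x≢ ∷ uw) with anyB (λ y → x ≡ᵇ y) w in eq
  ... | false = complete uw
  ... | true  = let y , y∈ , x≡y = T-anyB⁻ (from T-≡ eq) in
                contradiction (≡ᵇ⇒≡ x y x≡y) (All.lookup x≢ y∈)

∈-wordsOf⁺ : ∀ {n} w → All (_∈ range n) w → w ∈ wordsOf n (length w)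
∈-wordsOf⁺ []      []        = here refl
∈-wordsOf⁺ (x ∷ w) (x∈ ∷ w∈) = ∈-concatMap⁺ _ (lose x∈ (∈-map⁺ (x ∷_) (∈-wordsOf⁺ w w∈)))

∈-wordsOf⁻ : ∀ {n} k {w} → w ∈ wordsOf n k → length w ≡ k × All (_∈ range n) w
∈-wordsOf⁻ zero    (here refl) = refl , []
∈-wordsOf⁻ {n} (suc k) w∈
  with x , x∈ , w∈map ← find (∈-concatMap⁻ (λ a → map (a ∷_) (wordsOf n k)) {xs = range n} w∈)
  with w , w∈′ , refl ← ∈-map⁻ (x ∷_) w∈map
  = let len≡ , w⊆ = ∈-wordsOf⁻ k w∈′ in cong suc len≡ , x∈ ∷ w⊆

Unique-wordsOf : ∀ n k → Unique (wordsOf n k)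
Unique-wordsOf n zero    = [] ∷ []
Unique-wordsOf n (suc k) = Unique.concat⁺
  (All.map⁺ (All.tabulate λ _ → Unique.map⁺ (λ { refl → refl }) (Unique-wordsOf n k)))
  (AllPairs.map⁺ (AllPairs.map disjoint (Unique-range n)))
  where
  disjoint : ∀ {a b} → a ≢ b → ∀ {w} → ¬ (w ∈ map (a ∷_) (wordsOf n k) × w ∈ map (b ∷_) (wordsOf n k))
  disjoint a≢b (w∈a , w∈b) with ∈-map⁻ _ w∈a | ∈-map⁻ _ w∈b
  ... | _ , _ , refl | _ , _ , refl = a≢b refl

Unique-perms : ∀ n → Unique (perms n)
Unique-perms n = Unique-filterB (Unique-wordsOf n n)

Unique⇒↭range : ∀ {n w} → length w ≡ n → All (_∈ range n) w → Unique w → w ↭ range n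
Unique⇒↭range {n} len≡ w⊆ uw = Unique-⊆-↭ uw (All.lookup w⊆) (trans len≡ (sym (length-range n)))

-- From here on a permutation of [n] is a word with `w ↭ range n`, since lengths, membership and
-- sums carry over along `↭`.
IsPerm⇒↭ : ∀ {n w} → IsPerm n w → w ↭ range n
IsPerm⇒↭ (len≡ , bounds , uw) = Unique⇒↭range len≡ (All.map (from ∈-range) bounds) uw

module _ {n w} (w↭ : w ↭ range n) where

  ↭range⇒length : length w ≡ n
  ↭range⇒length = trans (↭-length w↭) (length-range n)

  ↭range⇒Unique : Unique w
  ↭range⇒Unique = Unique-resp-↭ (↭-sym w↭) (Unique-range n)

  ∈-perms⁺ : w ∈ perms n
  ∈-perms⁺ = ∈-filterB⁺ (subst (λ k → w ∈ wordsOf n k) ↭range⇒length (∈-wordsOf⁺ w (All.tabulate (∈-resp-↭ w↭))))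
                        (from T-distinctB ↭range⇒Unique)

∈-perms⁻ : ∀ {n w} → w ∈ perms n → w ↭ range n
∈-perms⁻ {n} w∈ =
  let w∈words , distinct = ∈-filterB⁻ w∈
      len≡ , w⊆          = ∈-wordsOf⁻ n w∈words
  in Unique⇒↭range len≡ w⊆ (to T-distinctB distinct)

-- Entries and positions

at0-applyUpTo : ∀ f {n k} → k < n → at0 (applyUpTo f n) k ≡ f k
at0-applyUpTo f {suc n} {zero}  _         = refl
at0-applyUpTo f {suc n} {suc k} (s≤s k<n) = at0-applyUpTo (f ∘ suc) k<n

at-map-range : ∀ f {n i} → i ∈ range n → at (map f (range n)) i ≡ f i
at-map-range f {n} i∈ with k , k<n , refl ← ∈-applyUpTo⁻ suc i∈ =
  trans (cong (λ w → at w (suc k)) (map-applyUpTo suc f n)) (at0-applyUpTo (f ∘ suc) k<n)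

map-at-range : ∀ u → map (at u) (range (length u)) ≡ u
map-at-range u = trans (map-applyUpTo suc (at u) (length u)) (applyUpTo-at0 u)
  where
  applyUpTo-at0 : ∀ u → applyUpTo (at0 u) (length u) ≡ u
  applyUpTo-at0 []      = refl
  applyUpTo-at0 (x ∷ u) = cong (x ∷_) (applyUpTo-at0 u)

at-∈ : ∀ u {i} → i ∈ range (length u) → at u i ∈ u
at-∈ u {i} i∈ = subst (at u i ∈_) (map-at-range u) (∈-map⁺ (at u) i∈)

∈⇒at : ∀ {u x} → x ∈ u → ∃ λ i → i ∈ range (length u) × x ≡ at u i
∈⇒at {u} x∈ = ∈-map⁻ (at u) (subst (_ ∈_) (sym (map-at-range u)) x∈)

pos-at : ∀ {u} → Unique u → ∀ {i} → i ∈ range (length u) → pos (at u i) u ≡ i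
pos-at uu i∈ with k , k< , refl ← ∈-applyUpTo⁻ suc i∈ = pos-at0 uu k<
  where
  at0-∈ : ∀ u {k} → k < length u → at0 u k ∈ u
  at0-∈ (x ∷ u) {zero}  _        = here refl
  at0-∈ (x ∷ u) {suc k} (s≤s k<) = there (at0-∈ u k<)
  pos-at0 : ∀ {u} → Unique u → ∀ {k} → k < length u → pos (at0 u k) u ≡ suc k
  pos-at0 {x ∷ u} _          {zero}  _        rewrite T⇒≡true (≡⇒≡ᵇ x x refl) = refl
  pos-at0 {x ∷ u} (x≢ ∷ uu) {suc k} (s≤s k<)
    rewrite ¬T⇒≡false (λ h → All.lookup x≢ (at0-∈ u k<) (sym (≡ᵇ⇒≡ (at0 u k) x h))) = cong suc (pos-at0 uu k<)

module _ {n w} (w↭ : w ↭ range n) where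

  map-at-↭ : map (at w) (range n) ≡ w
  map-at-↭ = subst (λ k → map (at w) (range k) ≡ w) (↭range⇒length w↭) (map-at-range w)

  pos-at-↭ : ∀ {i} → i ∈ range n → pos (at w i) w ≡ i
  pos-at-↭ i∈ = pos-at (↭range⇒Unique w↭) (subst (λ k → _ ∈ range k) (sym (↭range⇒length w↭)) i∈)

  at-∈-↭ : ∀ {i} → i ∈ range n → at w i ∈ range n
  at-∈-↭ i∈ = ∈-resp-↭ w↭ (at-∈ w (subst (λ k → _ ∈ range k) (sym (↭range⇒length w↭)) i∈))

  at-surjective : ∀ {x} → x ∈ range n → ∃ λ i → i ∈ range n × x ≡ at w i
  at-surjective x∈ = let i , i∈ , eq = ∈⇒at (∈-resp-↭ (↭-sym w↭) x∈)
                     in i , subst (λ k → i ∈ range k) (↭range⇒length w↭) i∈ , eq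

  at-injective : ∀ {i j} → i ∈ range n → j ∈ range n → at w i ≡ at w j → i ≡ j
  at-injective i∈ j∈ eq = trans (sym (pos-at-↭ i∈)) (trans (cong (λ x → pos x w) eq) (pos-at-↭ j∈))

  map-pos-↭ : map (λ x → pos x w) w ≡ range n
  map-pos-↭ = begin
    map (λ x → pos x w) w                        ≡⟨ cong (map _) map-at-↭ ⟨
    map (λ x → pos x w) (map (at w) (range n))   ≡⟨ map-∘ (range n) ⟨
    map (λ i → pos (at w i) w) (range n)         ≡⟨ map-cong-local (All.tabulate pos-at-↭) ⟩
    map (λ i → i) (range n)                      ≡⟨ map-id (range n) ⟩
    range n                                      ∎
    where open ≡-Reasoning

  inverse≡ : inverse w ≡ map (λ i → pos i w) (range n)
  inverse≡ = cong (λ k → map (λ i → pos i w) (range k)) (↭range⇒length w↭)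

  inverse-↭ : inverse w ↭ range n
  inverse-↭ = ↭-trans (↭-reflexive inverse≡) (↭-trans (↭-map⁺ _ (↭-sym w↭)) (↭-reflexive map-pos-↭))

  at-inverse : ∀ {i} → i ∈ range n → at (inverse w) i ≡ pos i w
  at-inverse {i} i∈ = trans (cong (λ v → at v i) inverse≡) (at-map-range (λ i → pos i w) i∈)

compose-↭ : ∀ {n u v} → u ↭ range n → v ↭ range n → compose u v ↭ range n
compose-↭ {u = u} u↭ v↭ = ↭-trans (↭-map⁺ (at u) v↭) (↭-trans (↭-reflexive (map-at-↭ u↭)) u↭)

at-map : ∀ f {n w i} → w ↭ range n → i ∈ range n → at (map f w) i ≡ f (at w i)
at-map f {n} {w} {i} w↭ i∈ = trans
  (cong (λ v → at v i) (trans (cong (map f) (sym (map-at-↭ w↭))) (sym (map-∘ (range n)))))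
  (at-map-range (f ∘ at w) i∈)

-- The offset is added on the right because `cross` shifts its second word that way.
range-+ : ∀ p q → range (p + q) ≡ range p ++ map (_+ p) (range q)
range-+ p q = begin
  range (p + q)                               ≡⟨ applyUpTo-+ suc p ⟩
  range p ++ applyUpTo (λ k → suc (p + k)) q  ≡⟨ cong (range p ++_) (map-applyUpTo (λ k → k) (λ k → suc (p + k)) q) ⟨
  range p ++ map (λ k → suc (p + k)) (upTo q) ≡⟨ cong (range p ++_) (map-cong (λ k → cong suc (+-comm p k)) (upTo q)) ⟩
  range p ++ map (λ k → suc (k + p)) (upTo q) ≡⟨ cong (range p ++_) (map-∘ (upTo q)) ⟩
  range p ++ map (_+ p) (map suc (upTo q))    ≡⟨ cong (λ l → range p ++ map (_+ p) l) (map-upTo suc q) ⟩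
  range p ++ map (_+ p) (range q)             ∎
  where
  open ≡-Reasoning
  applyUpTo-+ : ∀ (f : ℕ → ℕ) p → applyUpTo f (p + q) ≡ applyUpTo f p ++ applyUpTo (λ k → f (p + k)) q
  applyUpTo-+ f zero    = refl
  applyUpTo-+ f (suc p) = cong (f 0 ∷_) (applyUpTo-+ (f ∘ suc) p)

cross-↭ : ∀ {p q u v} → u ↭ range p → v ↭ range q → cross u v ↭ range (p + q)
cross-↭ {p} {q} u↭ v↭ rewrite ↭range⇒length u↭ =
  ↭-trans (++⁺ u↭ (↭-map⁺ (_+ p) v↭)) (↭-reflexive (sym (range-+ p q)))

-- Sums over pairs of entries

pairSum : (ℕ → ℕ → ℕ) → List ℕ → ℕ
pairSum g []       = 0
pairSum g (x ∷ xs) = sum (map (g x) xs) + pairSum g xs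

-- Swapping two neighbours exchanges their rows and reverses one pair, which the symmetry of g
-- absorbs. This lets `len-left-factor` pass from values in increasing order to values in the order
-- in which u lists them.
pairSum-↭ : ∀ {g} → (∀ x y → g x y ≡ g y x) → ∀ {xs ys} → xs ↭ ys → pairSum g xs ≡ pairSum g ys
pairSum-↭ {g} g-sym _↭_.refl            = refl
pairSum-↭ {g} g-sym (_↭_.prep x p)      = cong₂ _+_ (sum-↭ (↭-map⁺ (g x) p)) (pairSum-↭ g-sym p)
pairSum-↭ {g} g-sym (_↭_.swap {xs} {ys} x y p)
  rewrite g-sym x y | sum-↭ (↭-map⁺ (g x) p) | sum-↭ (↭-map⁺ (g y) p) | pairSum-↭ g-sym p =
  +-CS.interchange (g y x) (sum (map (g x) ys)) (sum (map (g y) ys)) (pairSum g ys)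
pairSum-↭ {g} g-sym (_↭_.trans p q)     = trans (pairSum-↭ g-sym p) (pairSum-↭ g-sym q)

pairSum-map : ∀ g f xs → pairSum g (map f xs) ≡ pairSum (λ x y → g (f x) (f y)) xs
pairSum-map g f []       = refl
pairSum-map g f (x ∷ xs) = cong₂ _+_ (cong sum (sym (map-∘ xs))) (pairSum-map g f xs)

sum-map-+ : ∀ (f g : ℕ → ℕ) xs → sum (map (λ x → f x + g x) xs) ≡ sum (map f xs) + sum (map g xs)
sum-map-+ f g []       = refl
sum-map-+ f g (x ∷ xs) = trans (cong (f x + g x +_) (sum-map-+ f g xs)) (+-CS.interchange (f x) (g x) _ _)

pairSum-+ : ∀ g h xs → pairSum (λ x y → g x y + h x y) xs ≡ pairSum g xs + pairSum h xs
pairSum-+ g h []       = refl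
pairSum-+ g h (x ∷ xs) = trans (cong₂ _+_ (sum-map-+ (g x) (h x) xs) (pairSum-+ g h xs))
                               (+-CS.interchange (sum (map (g x) xs)) _ _ _)

-- `range n` is increasing, so the earlier member of each pair is the smaller one and only i < j
-- matters.
pairSum-range-cong : ∀ {n g h} →
  (∀ {i j} → i ∈ range n → j ∈ range n → i < j → g i j ≡ h i j) →
  pairSum g (range n) ≡ pairSum h (range n)
pairSum-range-cong {n} {g} {h} g≗h = go suc n λ i<j j<n →
  g≗h (∈-applyUpTo⁺ suc (<-trans i<j j<n)) (∈-applyUpTo⁺ suc j<n) (s<s i<j)
  where
  go : ∀ f n → (∀ {i j} → i < j → j < n → g (f i) (f j) ≡ h (f i) (f j)) →
       pairSum g (applyUpTo f n) ≡ pairSum h (applyUpTo f n)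
  go f zero    eq = refl
  go f (suc n) eq = cong₂ _+_
    (cong sum (map-cong-local (All.applyUpTo⁺₁ (f ∘ suc) n (λ j<n → eq z<s (s<s j<n)))))
    (go (f ∘ suc) n (λ i<j j<n → eq (s<s i<j) (s<s j<n)))

sum-map≡0 : ∀ {f : ℕ → ℕ} {xs x} → sum (map f xs) ≡ 0 → x ∈ xs → f x ≡ 0
sum-map≡0 {f} {y ∷ xs} eq (here refl) = m+n≡0⇒m≡0 (f y) eq
sum-map≡0 {f} {y ∷ xs} eq (there x∈)  = sum-map≡0 (m+n≡0⇒n≡0 (f y) eq) x∈

pairSum-range≡0 : ∀ {n g} → pairSum g (range n) ≡ 0 →
  ∀ {i j} → i ∈ range n → j ∈ range n → i < j → g i j ≡ 0
pairSum-range≡0 {n} {g} eq i∈ j∈ i<j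
  with _ , _ , refl ← ∈-applyUpTo⁻ suc i∈ | _ , j<n , refl ← ∈-applyUpTo⁻ suc j∈ = go suc n eq (s<s⁻¹ i<j) j<n
  where
  go : ∀ f n → pairSum g (applyUpTo f n) ≡ 0 → ∀ {i j} → i < j → j < n → g (f i) (f j) ≡ 0
  go f (suc n) eq {zero}  {suc j} _   j<n = sum-map≡0 (m+n≡0⇒m≡0 _ eq) (∈-applyUpTo⁺ (f ∘ suc) (s<s⁻¹ j<n))
  go f (suc n) eq {suc i} {suc j} i<j j<n =
    go (f ∘ suc) n (m+n≡0⇒n≡0 (sum (map (g (f 0)) (applyUpTo (f ∘ suc) n))) eq) (s<s⁻¹ i<j) (s<s⁻¹ j<n)

𝟙 : Bool → ℕ
𝟙 b = if b then 1 else 0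

length-filterB : ∀ {A : Set} (p : A → Bool) xs → length (filterB p xs) ≡ sum (map (𝟙 ∘ p) xs)
length-filterB p []       = refl
length-filterB p (x ∷ xs) with p x
... | true  = cong suc (length-filterB p xs)
... | false = length-filterB p xs

len≡pairSum : ∀ w → len w ≡ pairSum (λ x y → 𝟙 (y <ᵇ x)) w
len≡pairSum []      = refl
len≡pairSum (x ∷ w) = cong₂ _+_ (length-filterB (_<ᵇ x) w) (len≡pairSum w)

-- Inclusion of inversion sets

<ᵇ-true : ∀ {m n} → m < n → (m <ᵇ n) ≡ true
<ᵇ-true m<n = T⇒≡true (<⇒<ᵇ m<n)

<ᵇ-false : ∀ {m n} → ¬ m < n → (m <ᵇ n) ≡ false
<ᵇ-false m≮n = ¬T⇒≡false (m≮n ∘ <ᵇ⇒< _ _)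

<ᵇ-asym : ∀ {m n} → m ≢ n → (n <ᵇ m) ≡ not (m <ᵇ n)
<ᵇ-asym {m} {n} m≢n with <-cmp m n
... | tri< m<n _ n≮m rewrite <ᵇ-true m<n | <ᵇ-false n≮m = refl
... | tri≈ _ m≡n _                                        = contradiction m≡n m≢n
... | tri> m≮n _ n<m rewrite <ᵇ-true n<m | <ᵇ-false m≮n = refl

-- On permutations of [n] this is the weak order, by `weakLeq⇒⊑` and `⊑⇒weakLeq`. It involves no
-- left factor, and reflexivity and transitivity become immediate.
_⊑[_]_ : Word → ℕ → Word → Set
u ⊑[ n ] v = ∀ i j → i ∈ range n → j ∈ range n → i < j → at u j < at u i → at v j < at v i

-- Counts the inversions of v that u lacks. With the arguments exchanged it counts those lost from u
-- to v, and for permutations it then vanishes exactly when `u ⊑[ n ] v`.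
gained : ℕ → Word → Word → ℕ
gained n u v = pairSum (λ i j → 𝟙 ((at u i <ᵇ at u j) ∧ (at v j <ᵇ at v i))) (range n)

len≡ : ∀ {n u} → u ↭ range n → len u ≡ pairSum (λ i j → 𝟙 (at u j <ᵇ at u i)) (range n)
len≡ {n} {u} u↭ = begin
  len u                                             ≡⟨ len≡pairSum u ⟩
  pairSum (λ x y → 𝟙 (y <ᵇ x)) u                     ≡⟨ cong (pairSum _) (map-at-↭ u↭) ⟨
  pairSum (λ x y → 𝟙 (y <ᵇ x)) (map (at u) (range n)) ≡⟨ pairSum-map _ (at u) (range n) ⟩
  pairSum (λ i j → 𝟙 (at u j <ᵇ at u i)) (range n)    ∎
  where open ≡-Reasoning

module _ {n u v} (u↭ : u ↭ range n) (v↭ : v ↭ range n) where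

  private
    <ᵇ-asym-at : ∀ {w i j} → w ↭ range n → i ∈ range n → j ∈ range n → i < j →
                 (at w j <ᵇ at w i) ≡ not (at w i <ᵇ at w j)
    <ᵇ-asym-at w↭ i∈ j∈ i<j = <ᵇ-asym (<⇒≢ i<j ∘ at-injective w↭ i∈ j∈)

  -- Both sides count the union of the two inversion sets; the additive form avoids truncated
  -- subtraction.
  len-exchange : len v + gained n v u ≡ gained n u v + len u
  len-exchange = begin
    len v + gained n v u                ≡⟨ cong (_+ gained n v u) (len≡ v↭) ⟩
    _                                   ≡⟨ pairSum-+ _ _ (range n) ⟨
    _                                   ≡⟨ pairSum-range-cong pointwise ⟩
    _                                   ≡⟨ pairSum-+ _ _ (range n) ⟩
    _                                   ≡⟨ cong (gained n u v +_) (len≡ u↭) ⟨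
    gained n u v + len u                ∎
    where
    open ≡-Reasoning
    -- Here a and b say that u and v, respectively, ascend from i to j; as entries are distinct,
    -- inversion is the negation.
    table : ∀ a b → 𝟙 (not b) + 𝟙 (b ∧ not a) ≡ 𝟙 (a ∧ not b) + 𝟙 (not a)
    table true  true  = refl
    table true  false = refl
    table false true  = refl
    table false false = refl
    pointwise : ∀ {i j} → i ∈ range n → j ∈ range n → i < j →
      𝟙 (at v j <ᵇ at v i) + 𝟙 ((at v i <ᵇ at v j) ∧ (at u j <ᵇ at u i)) ≡
      𝟙 ((at u i <ᵇ at u j) ∧ (at v j <ᵇ at v i)) + 𝟙 (at u j <ᵇ at u i)
    pointwise {i} {j} i∈ j∈ i<j
      rewrite <ᵇ-asym-at u↭ i∈ j∈ i<j | <ᵇ-asym-at v↭ i∈ j∈ i<j = table (at u i <ᵇ at u j) (at v i <ᵇ at v j)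

  gained≡0⇒⊑ : gained n v u ≡ 0 → u ⊑[ n ] v
  gained≡0⇒⊑ eq i j i∈ j∈ i<j uj<ui with <-cmp (at v j) (at v i) | pairSum-range≡0 eq i∈ j∈ i<j
  ... | tri< vj<vi _ _ | _ = vj<vi
  ... | tri≈ _ vj≡vi _ | _ = contradiction (sym (at-injective v↭ j∈ i∈ vj≡vi)) (<⇒≢ i<j)
  ... | tri> _ _ vi<vj | ≡0 rewrite <ᵇ-true vi<vj | <ᵇ-true uj<ui with () ← ≡0

  ⊑⇒gained≡0 : u ⊑[ n ] v → gained n v u ≡ 0
  ⊑⇒gained≡0 u⊑v = trans (pairSum-range-cong pointwise) (pairSum-0 (range n))
    where
    pairSum-0 : ∀ xs → pairSum (λ _ _ → 0) xs ≡ 0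
    pairSum-0 []       = refl
    pairSum-0 (x ∷ xs) = cong₂ _+_ (sum-0 xs) (pairSum-0 xs)
      where
      sum-0 : (xs : List ℕ) → sum (map (λ _ → 0) xs) ≡ 0
      sum-0 []       = refl
      sum-0 (_ ∷ xs) = sum-0 xs
    pointwise : ∀ {i j} → i ∈ range n → j ∈ range n → i < j →
                𝟙 ((at v i <ᵇ at v j) ∧ (at u j <ᵇ at u i)) ≡ 0
    pointwise {i} {j} i∈ j∈ i<j with at u j <? at u i
    ... | yes uj<ui rewrite <ᵇ-false (<-asym (u⊑v i j i∈ j∈ i<j uj<ui)) = refl
    ... | no  uj≮ui rewrite <ᵇ-false uj≮ui = cong 𝟙 (∧-zeroʳ _)

-- A pair of values {a, b} is inverted by w exactly when u and wu disagree on the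
-- positions of a and b; so, indexed by positions in u, the inversions of w are those gained and those lost from u to wu.
len-left-factor : ∀ {n u w} → u ↭ range n → w ↭ range n →
                  len w ≡ gained n u (compose w u) + gained n (compose w u) u
len-left-factor {n} {u} {w} u↭ w↭ = begin
  len w                                                     ≡⟨ len≡ w↭ ⟩
  pairSum (λ a b → 𝟙 (at w b <ᵇ at w a)) (range n)            ≡⟨ pairSum-range-cong {n} (λ _ _ → ascending) ⟩
  pairSum disagree (range n)                                ≡⟨ pairSum-↭ (λ a b → +-comm (K a b) (K b a)) u↭ ⟨
  pairSum disagree u                                        ≡⟨ cong (pairSum disagree) (map-at-↭ u↭) ⟨
  pairSum disagree (map (at u) (range n))                   ≡⟨ pairSum-map disagree (at u) (range n) ⟩
  pairSum (λ i j → disagree (at u i) (at u j)) (range n)    ≡⟨ pairSum-range-cong (λ i∈ j∈ _ → positions i∈ j∈) ⟩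
  _                                                         ≡⟨ pairSum-+ _ _ (range n) ⟩
  gained n u (compose w u) + gained n (compose w u) u       ∎
  where
  open ≡-Reasoning
  K disagree : ℕ → ℕ → ℕ
  K a b        = 𝟙 ((a <ᵇ b) ∧ (at w b <ᵇ at w a))
  disagree a b = K a b + K b a
  ascending : ∀ {a b} → a < b → 𝟙 (at w b <ᵇ at w a) ≡ disagree a b
  ascending a<b rewrite <ᵇ-true a<b | <ᵇ-false (<-asym a<b) = sym (+-identityʳ _)
  positions : ∀ {i j} → i ∈ range n → j ∈ range n → disagree (at u i) (at u j) ≡
    𝟙 ((at u i <ᵇ at u j) ∧ (at (compose w u) j <ᵇ at (compose w u) i)) +
    𝟙 ((at (compose w u) i <ᵇ at (compose w u) j) ∧ (at u j <ᵇ at u i))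
  positions {i} {j} i∈ j∈ rewrite at-map (at w) u↭ i∈ | at-map (at w) u↭ j∈ =
    cong (K (at u i) (at u j) +_) (cong 𝟙 (∧-comm (at u j <ᵇ at u i) _))

module _ {n u v} (u↭ : u ↭ range n) (v↭ : v ↭ range n) where

  -- Let g inversions be gained and l lost from u to v = wu. Then ℓ(w) = g + l and ℓ(v) + l = g +
  -- ℓ(u), so ℓ(v) + 2l = ℓ(w) + ℓ(u) = ℓ(v), which forces l = 0.
  weakLeq⇒⊑ : T (weakLeq u v) → u ⊑[ n ] v
  weakLeq⇒⊑ u≤v
    with w , w∈ , h ← T-anyB⁻ u≤v
    with v≡wu , len≡ᵇ ← to T-∧ h
    with refl ← to (T-eqW {v} {compose w u}) v≡wu =
    gained≡0⇒⊑ u↭ v↭ (m+n≡0⇒m≡0 (gained n v u) (+-cancelˡ-≡ (len v) _ 0 (begin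
      len v + (gained n v u + gained n v u)                  ≡⟨ +-assoc (len v) _ _ ⟨
      len v + gained n v u + gained n v u                    ≡⟨ cong (_+ gained n v u) (len-exchange u↭ v↭) ⟩
      gained n u v + len u + gained n v u                    ≡⟨ +-CS.xy∙z≈xz∙y (gained n u v) (len u) _ ⟩
      gained n u v + gained n v u + len u                    ≡⟨ cong (_+ len u) (len-left-factor u↭ w↭) ⟨
      len w + len u                                          ≡⟨ ≡ᵇ⇒≡ (len v) _ len≡ᵇ ⟨
      len v                                                  ≡⟨ +-identityʳ _ ⟨
      len v + 0                                              ∎)))
    where
    open ≡-Reasoning
    w↭ : w ↭ range n
    w↭ = ∈-perms⁻ (subst (λ k → w ∈ perms k) (↭range⇒length u↭) w∈)

  ⊑⇒weakLeq : u ⊑[ n ] v → T (weakLeq u v)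
  ⊑⇒weakLeq u⊑v = T-anyB⁺ (subst (λ k → w ∈ perms k) (sym (↭range⇒length u↭)) (∈-perms⁺ w↭))
    (from T-∧ (from T-eqW (sym wu≡v) , ≡⇒≡ᵇ (len v) _ len≡len))
    where
    open ≡-Reasoning
    -- The left factor is forced to be v u⁻¹. Since no inversion is lost, its length is the number
    -- of those gained.
    w = compose v (inverse u)
    w↭ : w ↭ range n
    w↭ = compose-↭ v↭ (inverse-↭ u↭)
    wu≡v : compose w u ≡ v
    wu≡v = begin
      map (at w) u                          ≡⟨ map-cong-local (All.tabulate at-w) ⟩
      map (at v ∘ (λ x → pos x u)) u        ≡⟨ map-∘ u ⟩
      map (at v) (map (λ x → pos x u) u)    ≡⟨ cong (map (at v)) (map-pos-↭ u↭) ⟩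
      map (at v) (range n)                  ≡⟨ map-at-↭ v↭ ⟩
      v                                     ∎
      where
      at-w : ∀ {x} → x ∈ u → at w x ≡ at v (pos x u)
      at-w x∈ = let x∈′ = ∈-resp-↭ u↭ x∈ in
                trans (at-map (at v) (inverse-↭ u↭) x∈′) (cong (at v) (at-inverse u↭ x∈′))
    len≡len : len v ≡ len w + len u
    len≡len = begin
      len v                                  ≡⟨ +-identityʳ _ ⟨
      len v + 0                              ≡⟨ cong (len v +_) (⊑⇒gained≡0 u↭ v↭ u⊑v) ⟨
      len v + gained n v u                   ≡⟨ len-exchange u↭ v↭ ⟩
      gained n u v + len u                   ≡⟨ cong (_+ len u) (+-identityʳ _) ⟨
      gained n u v + 0 + len u               ≡⟨ cong (λ e → gained n u v + e + len u) (⊑⇒gained≡0 u↭ v↭ u⊑v) ⟨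
      gained n u v + gained n v u + len u    ≡⟨ cong (λ x → gained n u x + gained n x u + len u) wu≡v ⟨
      gained n u (compose w u) + gained n (compose w u) u + len u ≡⟨ cong (_+ len u) (len-left-factor u↭ w↭) ⟨
      len w + len u                          ∎

-- Standardization

rank : ℕ → List ℕ → ℕ
rank x w = sum (map (λ y → 𝟙 (y <ᵇ x)) w)

st : List ℕ → Word
st w = map (λ x → suc (rank x w)) w

-- Rank ignores the order of the entries, so it can be computed in `range n`. This recovers an entry
-- of a permutation from its comparisons with the others.
suc-rank : ∀ {n w x} → w ↭ range n → x ∈ range n → suc (rank x w) ≡ x
suc-rank {n} {w} w↭ x∈ with k , k<n , refl ← ∈-applyUpTo⁻ suc x∈ = cong suc (begin
  rank (suc k) w                                    ≡⟨ sum-↭ (↭-map⁺ _ w↭) ⟩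
  sum (map (λ y → 𝟙 (y <ᵇ suc k)) (range n))        ≡⟨ cong sum (map-applyUpTo suc (λ y → 𝟙 (y <ᵇ suc k)) n) ⟩
  sum (applyUpTo (λ y → 𝟙 (y <ᵇ k)) n)              ≡⟨ count (<⇒≤ k<n) ⟩
  k                                                 ∎)
  where
  open ≡-Reasoning
  count : ∀ {k n} → k ≤ n → sum (applyUpTo (λ y → 𝟙 (y <ᵇ k)) n) ≡ k
  count {zero}  {zero}  _         = refl
  count {zero}  {suc n} _         = count {zero} {n} z≤n
  count {suc k} {suc n} (s≤s k≤n) = cong suc (count k≤n)

-- The inversion set settles every comparison of two entries, for i > j by negation; the comparisons
-- give the ranks, and the ranks are the entries up to the shift by one.
⊑-antisym : ∀ {n u v} → u ↭ range n → v ↭ range n → u ⊑[ n ] v → v ⊑[ n ] u → u ≡ v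
⊑-antisym {n} {u} {v} u↭ v↭ u⊑v v⊑u = begin
  u                       ≡⟨ map-at-↭ u↭ ⟨
  map (at u) (range n)    ≡⟨ map-cong-local (All.tabulate entry) ⟩
  map (at v) (range n)    ≡⟨ map-at-↭ v↭ ⟩
  v                       ∎
  where
  open ≡-Reasoning
  ascending : ∀ {i j} → i ∈ range n → j ∈ range n → i < j → (at u j <ᵇ at u i) ≡ (at v j <ᵇ at v i)
  ascending {i} {j} i∈ j∈ i<j = T-ext (λ h → <⇒<ᵇ (u⊑v i j i∈ j∈ i<j (<ᵇ⇒< _ _ h)))
                                      (λ h → <⇒<ᵇ (v⊑u i j i∈ j∈ i<j (<ᵇ⇒< _ _ h)))
  concordant : ∀ {i j} → i ∈ range n → j ∈ range n → (at u j <ᵇ at u i) ≡ (at v j <ᵇ at v i)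
  concordant {i} {j} i∈ j∈ with <-cmp i j
  ... | tri< i<j _ _ = ascending i∈ j∈ i<j
  ... | tri≈ _ refl _ = trans (<ᵇ-false (<-irrefl {at u i} refl)) (sym (<ᵇ-false (<-irrefl {at v i} refl)))
  ... | tri> _ i≢j j<i = begin
    (at u j <ᵇ at u i)       ≡⟨ <ᵇ-asym (i≢j ∘ at-injective u↭ i∈ j∈) ⟩
    not (at u i <ᵇ at u j)   ≡⟨ cong not (ascending j∈ i∈ j<i) ⟩
    not (at v i <ᵇ at v j)   ≡⟨ <ᵇ-asym (i≢j ∘ at-injective v↭ i∈ j∈) ⟨
    (at v j <ᵇ at v i)       ∎
  rank-at : ∀ {w} → w ↭ range n → ∀ x → rank x w ≡ sum (map (λ j → 𝟙 (at w j <ᵇ x)) (range n))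
  rank-at {w} w↭ x = trans (cong (rank x) (sym (map-at-↭ w↭))) (cong sum (sym (map-∘ (range n))))
  entry : ∀ {i} → i ∈ range n → at u i ≡ at v i
  entry {i} i∈ = begin
    at u i                                                      ≡⟨ suc-rank u↭ (at-∈-↭ u↭ i∈) ⟨
    suc (rank (at u i) u)                                       ≡⟨ cong suc (rank-at u↭ (at u i)) ⟩
    suc (sum (map (λ j → 𝟙 (at u j <ᵇ at u i)) (range n)))      ≡⟨ cong (suc ∘ sum) (map-cong-local
                                                                      (All.tabulate (cong 𝟙 ∘ concordant i∈))) ⟩
    suc (sum (map (λ j → 𝟙 (at v j <ᵇ at v i)) (range n)))      ≡⟨ cong suc (rank-at v↭ (at v i)) ⟨
    suc (rank (at v i) v)                                       ≡⟨ suc-rank v↭ (at-∈-↭ v↭ i∈) ⟩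
    at v i                                                      ∎

-- With nothing lost, ℓ(v) exceeds ℓ(u) by the number of inversions gained; were that zero,
-- antisymmetry would give u = v.
⊑⇒len< : ∀ {n u v} → u ↭ range n → v ↭ range n → u ⊑[ n ] v → u ≢ v → len u < len v
⊑⇒len< {n} {u} {v} u↭ v↭ u⊑v u≢v = subst (len u <_) (sym len-v) (m<n+m (len u) (n≢0⇒n>0 λ gained≡0 →
  u≢v (⊑-antisym u↭ v↭ u⊑v (gained≡0⇒⊑ v↭ u↭ gained≡0))))
  where
  len-v : len v ≡ gained n u v + len u
  len-v = trans (sym (+-identityʳ _))
            (trans (cong (len v +_) (sym (⊑⇒gained≡0 u↭ v↭ u⊑v))) (len-exchange u↭ v↭))

sum-map-≤ : ∀ {f g : ℕ → ℕ} xs → (∀ {x} → x ∈ xs → f x ≤ g x) → sum (map f xs) ≤ sum (map g xs)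
sum-map-≤ []       f≤g = z≤n
sum-map-≤ (x ∷ xs) f≤g = +-mono-≤ (f≤g (here refl)) (sum-map-≤ xs (f≤g ∘ there))

sum-map-< : ∀ {f g : ℕ → ℕ} {xs x} → (∀ {y} → y ∈ xs → f y ≤ g y) → x ∈ xs → f x < g x →
            sum (map f xs) < sum (map g xs)
sum-map-< {xs = y ∷ xs} f≤g (here refl) fx<gx = +-mono-<-≤ fx<gx (sum-map-≤ xs (f≤g ∘ there))
sum-map-< {xs = y ∷ xs} f≤g (there x∈)  fx<gx = +-mono-≤-< (f≤g (here refl)) (sum-map-< (f≤g ∘ there) x∈ fx<gx)

-- Strict because x itself is counted below y but not below x.
rank-< : ∀ {w x y} → x ∈ w → x < y → rank x w < rank y w
rank-< {w} {x} {y} x∈ x<y = sum-map-< (λ {z} _ → mono z) x∈ strict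
  where
  mono : ∀ z → 𝟙 (z <ᵇ x) ≤ 𝟙 (z <ᵇ y)
  mono z with z <? x
  ... | yes z<x rewrite <ᵇ-true z<x | <ᵇ-true (<-trans z<x x<y) = ≤-refl
  ... | no  z≮x rewrite <ᵇ-false z≮x                            = z≤n
  strict : 𝟙 (x <ᵇ x) < 𝟙 (x <ᵇ y)
  strict rewrite <ᵇ-false (<-irrefl {x} refl) | <ᵇ-true x<y = z<s

rank-<⁻ : ∀ {w x y} → y ∈ w → rank x w < rank y w → x < y
rank-<⁻ {w} {x} {y} y∈ rx<ry with <-cmp x y
... | tri< x<y _ _  = x<y
... | tri≈ _ refl _ = contradiction rx<ry (<-irrefl refl)
... | tri> _ _ y<x  = contradiction rx<ry (<-asym (rank-< y∈ y<x))

rank-injective : ∀ {w x y} → x ∈ w → y ∈ w → rank x w ≡ rank y w → x ≡ y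
rank-injective {w} {x} {y} x∈ y∈ eq with <-cmp x y
... | tri< x<y _ _ = contradiction eq (<⇒≢ (rank-< x∈ x<y))
... | tri≈ _ x≡y _ = x≡y
... | tri> _ _ y<x = contradiction (sym eq) (<⇒≢ (rank-< y∈ y<x))

rank<length : ∀ {w x} → x ∈ w → rank x w < length w
rank<length {w} {x} x∈ = subst (rank x w <_) (sum-1 w) (sum-map-< (λ {y} _ → 𝟙≤1 (y <ᵇ x)) x∈ strict)
  where
  sum-1 : (w : List ℕ) → sum (map (λ _ → 1) w) ≡ length w
  sum-1 []      = refl
  sum-1 (_ ∷ w) = cong suc (sum-1 w)
  𝟙≤1 : ∀ b → 𝟙 b ≤ 1
  𝟙≤1 true  = ≤-refl
  𝟙≤1 false = z≤n
  strict : 𝟙 (x <ᵇ x) < 1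
  strict rewrite <ᵇ-false (<-irrefl {x} refl) = z<s

Unique-map-local : ∀ {A B : Set} {f : A → B} {xs} → (∀ {x y} → x ∈ xs → y ∈ xs → f x ≡ f y → x ≡ y) →
                   Unique xs → Unique (map f xs)
Unique-map-local {xs = []}     inj []         = []
Unique-map-local {xs = x ∷ xs} inj (x≢ ∷ uxs) =
  All.map⁺ (All.tabulate λ y∈ fx≡fy → All.lookup x≢ y∈ (inj (here refl) (there y∈) fx≡fy))
  ∷ Unique-map-local (λ x∈ y∈ → inj (there x∈) (there y∈)) uxs

st-↭ : ∀ {w} → Unique w → st w ↭ range (length w)
st-↭ {w} uw = Unique⇒↭range (length-map _ w)
  (All.map⁺ (All.tabulate λ x∈ → from ∈-range (s≤s z≤n , rank<length x∈)))
  (Unique-map-local (λ x∈ y∈ → rank-injective x∈ y∈ ∘ suc-injective) uw)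

module _ (f : ℕ → ℕ) (n : ℕ) where

  st-map-range-↭ : (∀ {i j} → i ∈ range n → j ∈ range n → f i ≡ f j → i ≡ j) →
                   st (map f (range n)) ↭ range n
  st-map-range-↭ f-inj = subst (λ k → st (map f (range n)) ↭ range k)
    (trans (length-map f (range n)) (length-range n)) (st-↭ (Unique-map-local f-inj (Unique-range n)))

  private
    at-st : ∀ {i} → i ∈ range n → at (st (map f (range n))) i ≡ suc (rank (f i) (map f (range n)))
    at-st {i} i∈ = trans (cong (λ w → at w i) (sym (map-∘ (range n)))) (at-map-range _ i∈)

  -- Order isomorphism with the original entries is, beside being a permutation, what later proofs
  -- use of `st`.
  st-< : ∀ {i j} → i ∈ range n → j ∈ range n →
         (at (st (map f (range n))) i < at (st (map f (range n))) j) ⇔ f i < f j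
  st-< i∈ j∈ rewrite at-st i∈ | at-st j∈ = mk⇔
    (λ { (s≤s h) → rank-<⁻ (∈-map⁺ f j∈) h })
    (λ h → s≤s (rank-< (∈-map⁺ f i∈) h))

-- Indicators and Kronecker deltas

eqW-sym : ∀ u v → eqW u v ≡ eqW v u
eqW-sym u v = T-ext (from (T-eqW {v}) ∘ sym ∘ to (T-eqW {u})) (from (T-eqW {u}) ∘ sym ∘ to (T-eqW {v}))

_≟W_ : (u v : Word) → Dec (u ≡ v)
_≟W_ = ≡-dec _≟_

eqW-refl : ∀ u → eqW u u ≡ true
eqW-refl u = T⇒≡true (from (T-eqW {u}) refl)

eqW-≢ : ∀ {u v} → u ≢ v → eqW u v ≡ false
eqW-≢ u≢v = ¬T⇒≡false (u≢v ∘ to T-eqW)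

∑-eqW : ∀ {xs x} → Unique xs → x ∈ xs → ∀ (f : Word → ℚ) → ∑ xs (λ y → ⟦ eqW x y ⟧ ℚ.* f y) ≡ f x
∑-eqW {y ∷ xs} (y≢ ∷ _) (here refl) f rewrite eqW-refl y = begin
  1ℚ ℚ.* f y ℚ.+ ∑ xs (λ z → ⟦ eqW y z ⟧ ℚ.* f z)
    ≡⟨ cong₂ ℚ._+_ (ℚ.*-identityˡ (f y)) (∑-zero xs λ {z} z∈ →
         trans (cong (λ b → ⟦ b ⟧ ℚ.* f z) (eqW-≢ (All.lookup y≢ z∈))) (ℚ.*-zeroˡ (f z))) ⟩
  f y ℚ.+ 0ℚ
    ≡⟨ ℚ.+-identityʳ (f y) ⟩
  f y ∎
  where open ≡-Reasoning
∑-eqW {y ∷ xs} {x} (y≢ ∷ uxs) (there x∈) f rewrite eqW-≢ (All.lookup y≢ x∈ ∘ sym) =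
  trans (cong₂ ℚ._+_ (ℚ.*-zeroˡ (f y)) (∑-eqW uxs x∈ f)) (ℚ.+-identityˡ (f x))

⟦⟧-sandwich : ∀ a b m → ⟦ a ⟧ ℚ.* (m ℚ.* ⟦ b ⟧) ≡ ⟦ a ∧ b ⟧ ℚ.* m
⟦⟧-sandwich a b m = begin
  ⟦ a ⟧ ℚ.* (m ℚ.* ⟦ b ⟧)   ≡⟨ cong (⟦ a ⟧ ℚ.*_) (ℚ.*-comm m ⟦ b ⟧) ⟩
  ⟦ a ⟧ ℚ.* (⟦ b ⟧ ℚ.* m)   ≡⟨ ℚ.*-assoc ⟦ a ⟧ ⟦ b ⟧ m ⟨
  ⟦ a ⟧ ℚ.* ⟦ b ⟧ ℚ.* m     ≡⟨ cong (ℚ._* m) (⟦⟧-∧ a b) ⟨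
  ⟦ a ∧ b ⟧ ℚ.* m           ∎
  where open ≡-Reasoning

-- Detaches the top element, marked by e, from an interval in `∑-mobius` and from an order ideal in
-- `≈-from-ideals`.
⟦⟧-split : ∀ a e m → (T e → T a) → ⟦ a ⟧ ℚ.* m ≡ ⟦ e ⟧ ℚ.* m ℚ.+ ⟦ a ∧ not e ⟧ ℚ.* m
⟦⟧-split true  true  m _   = sym (trans (cong (1ℚ ℚ.* m ℚ.+_) (ℚ.*-zeroˡ m)) (ℚ.+-identityʳ _))
⟦⟧-split true  false m _   = sym (trans (cong (ℚ._+ 1ℚ ℚ.* m) (ℚ.*-zeroˡ m)) (ℚ.+-identityˡ _))
⟦⟧-split false false m _   = sym (trans (cong (ℚ._+ 0ℚ ℚ.* m) (ℚ.*-zeroˡ m)) (ℚ.+-identityˡ _))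
⟦⟧-split false true  m e⇒a = ⊥-elim (e⇒a tt)

-- The weak order

-- Bracketed so that `weakLeq u z ∧ below v z` is by definition the filter inside `mobiusFuel`.
below : Word → Word → Bool
below v z = weakLeq z v ∧ not (eqW z v)

module _ {n : ℕ} where

  weakLeq-refl : ∀ {u} → u ↭ range n → T (weakLeq u u)
  weakLeq-refl u↭ = ⊑⇒weakLeq u↭ u↭ λ _ _ _ _ _ h → h

  weakLeq-trans : ∀ {u v w} → u ↭ range n → v ↭ range n → w ↭ range n →
                  T (weakLeq u v) → T (weakLeq v w) → T (weakLeq u w)
  weakLeq-trans u↭ v↭ w↭ u≤v v≤w = ⊑⇒weakLeq u↭ w↭ λ i j i∈ j∈ i<j →
    weakLeq⇒⊑ v↭ w↭ v≤w i j i∈ j∈ i<j ∘ weakLeq⇒⊑ u↭ v↭ u≤v i j i∈ j∈ i<j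

  weakLeq-antisym : ∀ {u v} → u ↭ range n → v ↭ range n → T (weakLeq u v) → T (weakLeq v u) → u ≡ v
  weakLeq-antisym u↭ v↭ u≤v v≤u = ⊑-antisym u↭ v↭ (weakLeq⇒⊑ u↭ v↭ u≤v) (weakLeq⇒⊑ v↭ u↭ v≤u)

  below⇒len< : ∀ {z v} → z ↭ range n → v ↭ range n → T (below v z) → len z < len v
  below⇒len< {z} {v} z↭ v↭ h with to T-∧ h
  ... | z≤v , z≢v = ⊑⇒len< z↭ v↭ (weakLeq⇒⊑ z↭ v↭ z≤v) λ { refl → subst (T ∘ not) (eqW-refl z) z≢v }

  eqW⇒weakLeq : ∀ {u v} → v ↭ range n → T (eqW u v) → T (weakLeq u v)
  eqW⇒weakLeq {u} {v} v↭ u≡v with refl ← to (T-eqW {u} {v}) u≡v = weakLeq-refl v↭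

-- The Möbius function

  -- The recursion descends only to shorter words, so any fuel above ℓ(v) gives the same value. This
  -- identifies the recursive calls, which run on fuel ℓ(v), with `mobius u z`, which runs on ℓ(z) +
  -- 1.
  mobiusFuel-stable : ∀ f g {u v} → u ↭ range n → v ↭ range n → len v < f → len v < g →
                      mobiusFuel f u v ≡ mobiusFuel g u v
  mobiusFuel-stable (suc f) (suc g) {u} {v} u↭ v↭ (s≤s v<f) (s≤s v<g) =
    cong (λ s → if eqW u v then 1ℚ else if weakLeq u v then ℚ.- s else 0ℚ)
      (∑-cong (filterB (λ z → weakLeq u z ∧ below v z) (perms (length u))) λ {z} z∈ →
        let z∈perms , h = ∈-filterB⁻ z∈
            z↭  = ∈-perms⁻ (subst (λ k → z ∈ perms k) (↭range⇒length u↭) z∈perms)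
            z<v = below⇒len< z↭ v↭ (proj₂ (to (T-∧ {weakLeq u z}) h))
        in mobiusFuel-stable f g u↭ z↭ (≤-trans z<v v<f) (≤-trans z<v v<g))

  mobius-diagonal : ∀ u → mobius u u ≡ 1ℚ
  mobius-diagonal u rewrite eqW-refl u = refl

  mobius-recursion : ∀ {u v} → u ↭ range n → v ↭ range n → u ≢ v → T (weakLeq u v) →
    mobius u v ≡ ℚ.- ∑ (perms n) (λ z → ⟦ weakLeq u z ∧ below v z ⟧ ℚ.* mobius u z)
  mobius-recursion {u} {v} u↭ v↭ u≢v u≤v rewrite eqW-≢ u≢v | T⇒≡true u≤v =
    cong ℚ.-_ (trans (trans
      (cong (λ k → ∑ (filterB (λ z → weakLeq u z ∧ below v z) (perms k)) (mobiusFuel (len v) u)) (↭range⇒length u↭))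
      (∑-cong (filterB (λ z → weakLeq u z ∧ below v z) (perms n)) λ {z} z∈ →
        let z∈perms , h = ∈-filterB⁻ z∈
            z↭  = ∈-perms⁻ z∈perms
            z<v = below⇒len< z↭ v↭ (proj₂ (to (T-∧ {weakLeq u z}) h))
        in mobiusFuel-stable (len v) (suc (len z)) u↭ z↭ z<v (n<1+n (len z))))
      (∑-filterB (λ z → weakLeq u z ∧ below v z) (perms n) (mobius u)))

  -- For u < v the recursion makes the top term cancel the rest of the interval; for u = v the
  -- interval is a point, and otherwise it is empty. Through `eval-M` this says S_v(𝓜_u) = [u = v].
  ∑-mobius : ∀ {u v} → u ↭ range n → v ↭ range n →
    ∑ (perms n) (λ z → ⟦ weakLeq u z ⟧ ℚ.* (mobius u z ℚ.* ⟦ weakLeq z v ⟧)) ≡ ⟦ eqW u v ⟧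
  ∑-mobius {u} {v} u↭ v↭ = trans (∑-cong (perms n) λ {z} _ → ⟦⟧-sandwich (weakLeq u z) (weakLeq z v) (mobius u z)) cases
    where
    open ≡-Reasoning
    I : Word → Bool
    I z = weakLeq u z ∧ weakLeq z v
    interval : ∀ z → T (I z) → T (weakLeq u z) × T (weakLeq z v)
    interval z = to (T-∧ {weakLeq u z})
    cases : ∑ (perms n) (λ z → ⟦ I z ⟧ ℚ.* mobius u z) ≡ ⟦ eqW u v ⟧
    cases with u ≟W v | T? (weakLeq u v)
    ... | yes refl | _ = begin
      ∑ (perms n) (λ z → ⟦ I z ⟧ ℚ.* mobius u z)      ≡⟨ ∑-cong (perms n) (λ {z} z∈ → cong (λ b → ⟦ b ⟧ ℚ.* mobius u z)
                                                           (trivial-interval z∈)) ⟩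
      ∑ (perms n) (λ z → ⟦ eqW u z ⟧ ℚ.* mobius u z)  ≡⟨ ∑-eqW (Unique-perms n) (∈-perms⁺ u↭) (mobius u) ⟩
      mobius u u                                      ≡⟨ mobius-diagonal u ⟩
      1ℚ                                              ≡⟨ cong ⟦_⟧ (eqW-refl u) ⟨
      ⟦ eqW u u ⟧                                     ∎
      where
      degenerate : ∀ {z} → u ≡ z → T (I z)
      degenerate refl = from T-∧ (weakLeq-refl {u} u↭ , weakLeq-refl {u} u↭)
      trivial-interval : ∀ {z} → z ∈ perms n → I z ≡ eqW u z
      trivial-interval {z} z∈ = T-ext
        (λ h → let u≤z , z≤u = interval z h in from (T-eqW {u} {z}) (weakLeq-antisym u↭ (∈-perms⁻ z∈) u≤z z≤u))
        (λ h → degenerate (to (T-eqW {u} {z}) h))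
    ... | no u≢v | no u≰v = begin
      ∑ (perms n) (λ z → ⟦ I z ⟧ ℚ.* mobius u z)      ≡⟨ ∑-zero (perms n) (λ {z} z∈ → trans (cong (λ b → ⟦ b ⟧ ℚ.* mobius u z)
                                                           (empty-interval z∈)) (ℚ.*-zeroˡ (mobius u z))) ⟩
      0ℚ                                              ≡⟨ cong ⟦_⟧ (eqW-≢ u≢v) ⟨
      ⟦ eqW u v ⟧                                     ∎
      where
      empty-interval : ∀ {z} → z ∈ perms n → I z ≡ false
      empty-interval {z} z∈ = ¬T⇒≡false λ h →
        let u≤z , z≤v = interval z h in u≰v (weakLeq-trans u↭ (∈-perms⁻ z∈) v↭ u≤z z≤v)
    ... | no u≢v | yes u≤v = begin
      ∑ (perms n) (λ z → ⟦ I z ⟧ ℚ.* mobius u z)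
        ≡⟨ ∑-cong (perms n) (λ {z} _ → ⟦⟧-split (I z) (eqW v z) (mobius u z) (top z ∘ to (T-eqW {v} {z}))) ⟩
      ∑ (perms n) (λ z → ⟦ eqW v z ⟧ ℚ.* mobius u z ℚ.+ ⟦ I z ∧ not (eqW v z) ⟧ ℚ.* mobius u z)
        ≡⟨ ∑-+ (perms n) _ _ ⟩
      ∑ (perms n) (λ z → ⟦ eqW v z ⟧ ℚ.* mobius u z) ℚ.+ ∑ (perms n) (λ z → ⟦ I z ∧ not (eqW v z) ⟧ ℚ.* mobius u z)
        ≡⟨ cong₂ ℚ._+_ (∑-eqW (Unique-perms n) (∈-perms⁺ v↭) (mobius u))
                       (∑-cong (perms n) λ {z} _ → cong (λ b → ⟦ b ⟧ ℚ.* mobius u z) (reassociate z)) ⟩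
      mobius u v ℚ.+ Σ<
        ≡⟨ cong (ℚ._+ Σ<) (mobius-recursion u↭ v↭ u≢v u≤v) ⟩
      ℚ.- Σ< ℚ.+ Σ<
        ≡⟨ ℚ.+-inverseˡ Σ< ⟩
      0ℚ
        ≡⟨ cong ⟦_⟧ (eqW-≢ u≢v) ⟨
      ⟦ eqW u v ⟧ ∎
      where
      Σ< : ℚ
      Σ< = ∑ (perms n) (λ z → ⟦ weakLeq u z ∧ below v z ⟧ ℚ.* mobius u z)
      top : ∀ z → v ≡ z → T (I z)
      top z refl = from T-∧ (u≤v , weakLeq-refl v↭)
      reassociate : ∀ z → I z ∧ not (eqW v z) ≡ weakLeq u z ∧ below v z
      reassociate z = trans (cong (λ b → I z ∧ not b) (eqW-sym v z)) (∧-assoc (weakLeq u z) (weakLeq z v) _)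

-- Linear functionals on 𝔖Sym

-- The linear functional with value g y on 𝓕_y. Coefficients and the S_w are both of this form, so
-- linearity is proved once for all of them.
eval : (Word → ℚ) → SSym → ℚ
eval g x = ∑ x (λ ay → proj₁ ay ℚ.* g (proj₂ ay))

coeff≡eval : ∀ x w → coeff x w ≡ eval (λ y → ⟦ eqW y w ⟧) x
coeff≡eval x w = ∑-cong x λ { {a , y} _ → term a (eqW y w) }
  where
  term : ∀ a b → (if b then a else 0ℚ) ≡ a ℚ.* ⟦ b ⟧
  term a true  = sym (ℚ.*-identityʳ a)
  term a false = sym (ℚ.*-zeroʳ a)

eval-• : ∀ g c x → eval g (c • x) ≡ c ℚ.* eval g x
eval-• g c x = trans (∑-map _ x _)
  (trans (∑-cong x λ { {a , y} _ → ℚ.*-assoc c a (g y) }) (∑-*ˡ c x _))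

eval-sumS : ∀ g xs → eval g (sumS xs) ≡ ∑ xs (eval g)
eval-sumS g []       = refl
eval-sumS g (x ∷ xs) = trans (∑-++ x (sumS xs) _) (cong (eval g x ℚ.+_) (eval-sumS g xs))

eval-M : ∀ g u → eval g (M u) ≡ ∑ (perms (length u)) (λ v → ⟦ weakLeq u v ⟧ ℚ.* (mobius u v ℚ.* g v))
eval-M g u = trans (∑-map (λ v → mobius u v , v) (filterB (weakLeq u) (perms (length u))) _)
                   (∑-filterB (weakLeq u) (perms (length u)) (λ v → mobius u v ℚ.* g v))

ρ : Word → Word → Word → Word
ρ ζ u v = compose (cross u v) (inverse ζ)

eval-· : ∀ g x y → eval g (x · y) ≡
  eval (λ u → eval (λ v → ∑ (grassmannian (length u) (length v)) (λ ζ → g (ρ ζ u v))) y) x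
eval-· g x y = begin
  eval g (x · y)
    ≡⟨ eval-sumS g (concatMap _ x) ⟩
  ∑ (concatMap _ x) (eval g)
    ≡⟨ ∑-concatMap _ x (eval g) ⟩
  ∑ x (λ au → ∑ (map (λ { (b , v) → (proj₁ au ℚ.* b) • prodF (proj₂ au) v }) y) (eval g))
    ≡⟨ ∑-cong x (λ { {a , u} _ → trans (∑-map _ y (eval g))
         (trans (∑-cong y λ { {b , v} _ → term a b u v }) (∑-*ˡ a y _)) }) ⟩
  _ ∎
  where
  open ≡-Reasoning
  G : Word → Word → ℚ
  G u v = ∑ (grassmannian (length u) (length v)) (λ ζ → g (ρ ζ u v))
  term : ∀ a b u v → eval g ((a ℚ.* b) • prodF u v) ≡ a ℚ.* (b ℚ.* G u v)
  term a b u v = trans (eval-• g (a ℚ.* b) (prodF u v)) (trans (cong (a ℚ.* b ℚ.*_)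
    (trans (∑-map (λ ζ → 1ℚ , ρ ζ u v) (grassmannian (length u) (length v)) _)
           (∑-cong (grassmannian (length u) (length v)) λ _ → ℚ.*-identityˡ _))) (ℚ.*-assoc a b (G u v)))

-- 𝔖Sym in degree n

Homogeneous : ℕ → SSym → Set
Homogeneous n x = ∀ {a y} → (a , y) ∈ x → y ↭ range n

module _ {n : ℕ} where

  -- `_≈_` compares coefficients at all words, so those that are not permutations of [n] have to be
  -- dealt with too.
  coeff-outside : ∀ {x} → Homogeneous n x → ∀ {w} → w ∉ perms n → coeff x w ≡ 0ℚ
  coeff-outside {x} hx {w} w∉ = trans (coeff≡eval x w) (∑-zero x λ { {a , y} ay∈ →
    trans (cong (λ b → a ℚ.* ⟦ b ⟧) (eqW-≢ λ y≡w → w∉ (subst (_∈ perms n) y≡w (∈-perms⁺ (hx ay∈))))) (ℚ.*-zeroʳ a) })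

  -- An index may occur several times in the list x; exchanging the sums collects its terms. Thus
  -- S_w depends on the coefficients alone.
  ∑-ideal-coeff : ∀ {x} → Homogeneous n x → ∀ w →
    ∑ (perms n) (λ y → ⟦ weakLeq y w ⟧ ℚ.* coeff x y) ≡ eval (λ y → ⟦ weakLeq y w ⟧) x
  ∑-ideal-coeff {x} hx w = begin
    ∑ (perms n) (λ y → ⟦ weakLeq y w ⟧ ℚ.* coeff x y)
      ≡⟨ ∑-cong (perms n) (λ {y} _ → trans (cong (⟦ weakLeq y w ⟧ ℚ.*_) (coeff≡eval x y)) (sym (∑-*ˡ ⟦ weakLeq y w ⟧ x _))) ⟩
    ∑ (perms n) (λ y → ∑ x (λ ay′ → ⟦ weakLeq y w ⟧ ℚ.* (proj₁ ay′ ℚ.* ⟦ eqW (proj₂ ay′) y ⟧)))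
      ≡⟨ ∑-swap (perms n) x _ ⟩
    ∑ x (λ ay′ → ∑ (perms n) (λ y → ⟦ weakLeq y w ⟧ ℚ.* (proj₁ ay′ ℚ.* ⟦ eqW (proj₂ ay′) y ⟧)))
      ≡⟨ ∑-cong x (λ { {a , y′} ay′∈ → begin
           ∑ (perms n) (λ y → ⟦ weakLeq y w ⟧ ℚ.* (a ℚ.* ⟦ eqW y′ y ⟧))
             ≡⟨ ∑-cong (perms n) (λ {y} _ → ℚ-*.x∙yz≈y∙zx ⟦ weakLeq y w ⟧ a ⟦ eqW y′ y ⟧) ⟩
           ∑ (perms n) (λ y → a ℚ.* (⟦ eqW y′ y ⟧ ℚ.* ⟦ weakLeq y w ⟧))
             ≡⟨ ∑-*ˡ a (perms n) _ ⟩
           a ℚ.* ∑ (perms n) (λ y → ⟦ eqW y′ y ⟧ ℚ.* ⟦ weakLeq y w ⟧)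
             ≡⟨ cong (a ℚ.*_) (∑-eqW (Unique-perms n) (∈-perms⁺ (hx ay′∈)) (λ y → ⟦ weakLeq y w ⟧)) ⟩
           a ℚ.* ⟦ weakLeq y′ w ⟧ ∎ }) ⟩
    eval (λ y → ⟦ weakLeq y w ⟧) x ∎
    where open ≡-Reasoning

  -- S_w is the coefficient at w plus coefficients at strictly smaller, hence shorter, permutations.
  -- By induction on length the latter agree and cancel.
  ≈-from-ideals : ∀ {x y} → Homogeneous n x → Homogeneous n y →
    (∀ {w} → w ↭ range n → eval (λ z → ⟦ weakLeq z w ⟧) x ≡ eval (λ z → ⟦ weakLeq z w ⟧) y) → x ≈ y
  ≈-from-ideals {x} {y} hx hy eq w with DecMembership._∈?_ _≟W_ w (perms n)
  ... | no w∉  = trans (coeff-outside hx w∉) (sym (coeff-outside hy w∉))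
  ... | yes w∈ = induct (suc (len w)) (∈-perms⁻ w∈) (n<1+n (len w))
    where
    induct : ∀ m {w} → w ↭ range n → len w < m → coeff x w ≡ coeff y w
    induct (suc m) {w} w↭ (s≤s w≤m) = ∙-cancelʳ ℚ.+-0-group (rest x) (coeff x w) (coeff y w) (begin
      coeff x w ℚ.+ rest x    ≡⟨ split x hx ⟩
      _                       ≡⟨ eq w↭ ⟩
      _                       ≡⟨ split y hy ⟨
      coeff y w ℚ.+ rest y    ≡⟨ cong (coeff y w ℚ.+_) (∑-cong (perms n) same) ⟨
      coeff y w ℚ.+ rest x    ∎)
      where
      open ≡-Reasoning
      rest : SSym → ℚ
      rest x = ∑ (perms n) (λ z → ⟦ weakLeq z w ∧ not (eqW w z) ⟧ ℚ.* coeff x z)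
      split : ∀ x → Homogeneous n x → coeff x w ℚ.+ rest x ≡ eval (λ z → ⟦ weakLeq z w ⟧) x
      split x hx = begin
        coeff x w ℚ.+ rest x
          ≡⟨ cong (ℚ._+ rest x) (∑-eqW (Unique-perms n) (∈-perms⁺ w↭) (coeff x)) ⟨
        ∑ (perms n) (λ z → ⟦ eqW w z ⟧ ℚ.* coeff x z) ℚ.+ rest x
          ≡⟨ ∑-+ (perms n) _ _ ⟨
        _
          ≡⟨ ∑-cong (perms n) (λ {z} _ → ⟦⟧-split (weakLeq z w) (eqW w z) (coeff x z)
               (eqW⇒weakLeq {n} {z} {w} w↭ ∘ subst T (eqW-sym w z))) ⟨
        ∑ (perms n) (λ z → ⟦ weakLeq z w ⟧ ℚ.* coeff x z)
          ≡⟨ ∑-ideal-coeff hx w ⟩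
        eval (λ z → ⟦ weakLeq z w ⟧) x ∎
      same : ∀ {z} → z ∈ perms n →
        ⟦ weakLeq z w ∧ not (eqW w z) ⟧ ℚ.* coeff x z ≡ ⟦ weakLeq z w ∧ not (eqW w z) ⟧ ℚ.* coeff y z
      same {z} z∈ with T? (below w z)
      ... | yes z<w = cong (⟦ weakLeq z w ∧ not (eqW w z) ⟧ ℚ.*_) 
        (induct m (∈-perms⁻ z∈) (≤-trans (below⇒len< (∈-perms⁻ z∈) w↭ z<w) w≤m))
      ... | no  z≮w rewrite eqW-sym w z | ¬T⇒≡false z≮w = trans (ℚ.*-zeroˡ (coeff x z)) (sym (ℚ.*-zeroˡ (coeff y z)))

-- Meant for f the indicator of the fibre of ρ_ζ: c is the indicator that the fibre is nonempty, g
-- and h are those of the two ideals, and s and t are the resulting Möbius sums.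
∑-separate : ∀ {A B : Set} (xs : List A) (ys : List B) (a m : A → ℚ) (b k : B → ℚ) (f : A → B → ℚ)
  (c : ℚ) (g : A → ℚ) (h : B → ℚ) {s t : ℚ} →
  (∀ {x y} → x ∈ xs → y ∈ ys → f x y ≡ c ℚ.* (g x ℚ.* h y)) →
  ∑ xs (λ x → a x ℚ.* (m x ℚ.* g x)) ≡ s → ∑ ys (λ y → b y ℚ.* (k y ℚ.* h y)) ≡ t →
  ∑ xs (λ x → a x ℚ.* (m x ℚ.* ∑ ys (λ y → b y ℚ.* (k y ℚ.* f x y)))) ≡ c ℚ.* (s ℚ.* t)
∑-separate xs ys a m b k f c g h {s} {t} f≡ refl refl = begin
  ∑ xs (λ x → a x ℚ.* (m x ℚ.* ∑ ys (λ y → b y ℚ.* (k y ℚ.* f x y))))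
    ≡⟨ ∑-cong xs (λ {x} x∈ → trans (cong (λ e → a x ℚ.* (m x ℚ.* e)) (inner x∈))
         (trans (pull (a x) (m x) c (g x ℚ.* t)) (cong (c ℚ.*_) (regroup (a x) (m x) (g x))))) ⟩
  ∑ xs (λ x → c ℚ.* (a x ℚ.* (m x ℚ.* g x) ℚ.* t))
    ≡⟨ ∑-*ˡ c xs _ ⟩
  c ℚ.* ∑ xs (λ x → a x ℚ.* (m x ℚ.* g x) ℚ.* t)
    ≡⟨ cong (c ℚ.*_) (∑-*ʳ t xs _) ⟩
  c ℚ.* (s ℚ.* t) ∎
  where
  open ≡-Reasoning
  pull : ∀ a m c e → a ℚ.* (m ℚ.* (c ℚ.* e)) ≡ c ℚ.* (a ℚ.* (m ℚ.* e))
  pull a m c e = trans (cong (a ℚ.*_) (ℚ-*.x∙yz≈y∙xz m c e)) (ℚ-*.x∙yz≈y∙xz a c (m ℚ.* e))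
  regroup : ∀ a m g → a ℚ.* (m ℚ.* (g ℚ.* t)) ≡ a ℚ.* (m ℚ.* g) ℚ.* t
  regroup a m g = trans (cong (a ℚ.*_) (sym (ℚ.*-assoc m g t))) (sym (ℚ.*-assoc a (m ℚ.* g) t))
  inner : ∀ {x} → x ∈ xs → ∑ ys (λ y → b y ℚ.* (k y ℚ.* f x y)) ≡ c ℚ.* (g x ℚ.* t)
  inner {x} x∈ = begin
    ∑ ys (λ y → b y ℚ.* (k y ℚ.* f x y))
      ≡⟨ ∑-cong ys (λ {y} y∈ → trans (cong (λ e → b y ℚ.* (k y ℚ.* e)) (f≡ x∈ y∈))
           (trans (pull (b y) (k y) c _) (cong (c ℚ.*_) (pull (b y) (k y) (g x) (h y))))) ⟩
    ∑ ys (λ y → c ℚ.* (g x ℚ.* (b y ℚ.* (k y ℚ.* h y))))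
      ≡⟨ ∑-*ˡ c ys _ ⟩
    c ℚ.* ∑ ys (λ y → g x ℚ.* (b y ℚ.* (k y ℚ.* h y)))
      ≡⟨ cong (c ℚ.*_) (∑-*ˡ (g x) ys _) ⟩
    c ℚ.* (g x ℚ.* t) ∎

-- Shuffles of two permutations

∈-range-left : ∀ {p i} q → i ∈ range p → i ∈ range (p + q)
∈-range-left {p} q i∈ = subst (_ ∈_) (sym (range-+ p q)) (∈-++⁺ˡ i∈)

∈-range-right : ∀ p {q j} → j ∈ range q → j + p ∈ range (p + q)
∈-range-right p {q} j∈ = subst (_ ∈_) (sym (range-+ p q)) (∈-++⁺ʳ (range p) (∈-map⁺ (_+ p) j∈))

range-split : ∀ p {q k} → k ∈ range (p + q) → k ∈ range p ⊎ (∃ λ j → j ∈ range q × k ≡ j + p)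
range-split p {q} k∈ with ∈-++⁻ (range p) (subst (_ ∈_) (range-+ p q) k∈)
... | inj₁ k∈p = inj₁ k∈p
... | inj₂ k∈q = inj₂ (∈-map⁻ (_+ p) k∈q)

module _ {p q u v} (u↭ : u ↭ range p) (v↭ : v ↭ range q) where

  at-cross-left : ∀ {i} → i ∈ range p → at (cross u v) i ≡ at u i
  at-cross-left i∈ with k , k<p , refl ← ∈-applyUpTo⁻ suc i∈ =
    at0-++ u (subst (k <_) (sym (↭range⇒length u↭)) k<p)
    where
    at0-++ : ∀ u {w k} → k < length u → at0 (u ++ w) k ≡ at0 u k
    at0-++ (x ∷ u) {k = zero}  _        = refl
    at0-++ (x ∷ u) {k = suc k} (s≤s k<) = at0-++ u k<

  at-cross-right : ∀ {j} → j ∈ range q → at (cross u v) (j + p) ≡ at v j + p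
  at-cross-right j∈ with k , k<q , refl ← ∈-applyUpTo⁻ suc j∈ | refl ← ↭range⇒length u↭ = trans
    (at0-++ u) (at-map (_+ length u) v↭ j∈)
    where
    at0-++ : ∀ u {w k} → at0 (u ++ w) (k + length u) ≡ at0 w k
    at0-++ []      {w} {k} = cong (at0 w) (+-identityʳ k)
    at0-++ (x ∷ u) {w} {k} = trans (cong (at0 (x ∷ u ++ w)) (+-suc k (length u))) (at0-++ u)

  -- Letters of u are at most p and shifted letters of v exceed p. This is why mixed pairs do not
  -- depend on u and v.
  cross-left<right : ∀ {i j} → i ∈ range p → j ∈ range q → at (cross u v) i < at (cross u v) (j + p)
  cross-left<right i∈ j∈ rewrite at-cross-left i∈ | at-cross-right j∈ =
    ≤-<-trans (proj₂ (to ∈-range (at-∈-↭ u↭ i∈))) (m<n+m p (proj₁ (to ∈-range (at-∈-↭ v↭ j∈))))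

module _ {p q ζ} (ζ∈ : ζ ∈ grassmannian p q) where

  grassmannian-↭ : ζ ↭ range (p + q)
  grassmannian-↭ = ∈-perms⁻ (proj₁ (∈-filterB⁻ {xs = perms (p + q)} ζ∈))

  -- With i < j, the last hypothesis puts both positions in one block, so the chain of ascents from
  -- i to j never crosses the possible descent at p.
  grassmannian-ascent : ∀ {i j} → i ∈ range (p + q) → j ∈ range (p + q) → i < j → j ≤ p ⊎ p < i → at ζ i < at ζ j
  grassmannian-ascent {i} {suc j} i∈ j∈ i<j block = go j (s≤s⁻¹ i<j) (proj₂ (to ∈-range j∈)) block
    where
    ascending : Word → ℕ → Bool
    ascending ζ i = (i ≡ᵇ p) ∨ (at ζ i <ᵇ at ζ (suc i))
    ascending-everywhere : T (allB (ascending ζ) (range (p + q ∸ 1)))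
    ascending-everywhere = proj₂ (∈-filterB⁻ {p = λ ζ → allB (ascending ζ) (range (p + q ∸ 1))} {xs = perms (p + q)} ζ∈)
    step : ∀ j → 1 ≤ j → suc j ≤ p + q → j ≢ p → at ζ j < at ζ (suc j)
    step j 1≤j j<n j≢p with to (T-∨ {j ≡ᵇ p})
      (T-allB⁻ {p = ascending ζ} ascending-everywhere (from ∈-range (1≤j , ∸-monoˡ-≤ 1 j<n)))
    ... | inj₁ j≡p = contradiction (≡ᵇ⇒≡ j p j≡p) j≢p
    ... | inj₂ asc = <ᵇ⇒< _ _ asc
    1≤i : 1 ≤ i
    1≤i = proj₁ (to ∈-range i∈)
    j≢p : ∀ {j} → i ≤ j → suc j ≤ p ⊎ p < i → j ≢ p
    j≢p i≤j (inj₁ j<p) = <⇒≢ j<p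
    j≢p i≤j (inj₂ p<i) = <⇒≢ (<-≤-trans p<i i≤j) ∘ sym
    go : ∀ j → i ≤ j → suc j ≤ p + q → suc j ≤ p ⊎ p < i → at ζ i < at ζ (suc j)
    go j i≤j j<n block with m≤n⇒m<n∨m≡n i≤j
    ... | inj₂ refl = step j 1≤i j<n (j≢p i≤j block)
    go (suc j) i≤j j<n block | inj₁ (s≤s i≤j′) = <-trans
      (go j i≤j′ (<⇒≤ j<n) (case block of λ { (inj₁ h) → inj₁ (<⇒≤ h) ; (inj₂ h) → inj₂ h }))
      (step (suc j) (s≤s z≤n) j<n (j≢p i≤j block))

  grassmannian-ascent⁻ : ∀ {i j} → i ∈ range (p + q) → j ∈ range (p + q) → at ζ i < at ζ j →
                         (i ≤ p × j ≤ p) ⊎ (p < i × p < j) → i < j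
  grassmannian-ascent⁻ {i} {j} i∈ j∈ ζi<ζj block with <-cmp i j
  ... | tri< i<j _ _  = i<j
  ... | tri≈ _ refl _ = contradiction ζi<ζj (<-irrefl refl)
  ... | tri> _ _ j<i  = contradiction ζi<ζj (<-asym (grassmannian-ascent j∈ i∈ j<i
                          (case block of λ { (inj₁ (i≤p , _)) → inj₁ i≤p ; (inj₂ (_ , p<j)) → inj₂ p<j })))

  module _ {u v} (u↭ : u ↭ range p) (v↭ : v ↭ range q) where

    ρ-↭ : ρ ζ u v ↭ range (p + q)
    ρ-↭ = compose-↭ (cross-↭ u↭ v↭) (inverse-↭ grassmannian-↭)

    -- Cancelling ζ⁻¹ against ζ shows that the letters of u stand at positions ζ(1), ..., ζ(p) of ρ,
    -- and those of v at the remaining ones.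
    at-ρ : ∀ {a} → a ∈ range (p + q) → at (ρ ζ u v) (at ζ a) ≡ at (cross u v) a
    at-ρ a∈ = let ζa∈ = at-∈-↭ grassmannian-↭ a∈ in
      trans (at-map (at (cross u v)) (inverse-↭ grassmannian-↭) ζa∈)
            (cong (at (cross u v)) (trans (at-inverse grassmannian-↭ ζa∈) (pos-at-↭ grassmannian-↭ a∈)))

  -- The fibre of ρ_ζ below z

  module _ {z} (z↭ : z ↭ range (p + q)) where

    -- The a and b of the overview. As ζ increases on each block, these subwords of z are read from
    -- left to right.
    leftMax rightMax : Word
    leftMax  = st (map (λ i → at z (at ζ i)) (range p))
    rightMax = st (map (λ j → at z (at ζ (j + p))) (range q))

    -- In ρ a mixed pair is inverted exactly when the letter from v stands first; z has to invert
    -- all such pairs. Neither u nor v enters.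
    InvertsCross : Set
    InvertsCross = ∀ i j → i ∈ range p → j ∈ range q → at ζ (j + p) < at ζ i → at z (at ζ i) < at z (at ζ (j + p))

    private
      L : ∀ {i} → i ∈ range p → i ∈ range (p + q)
      L = ∈-range-left q
      R : ∀ {j} → j ∈ range q → j + p ∈ range (p + q)
      R = ∈-range-right p
      i≤p : ∀ {i} → i ∈ range p → i ≤ p
      i≤p = proj₂ ∘ to ∈-range
      p<j+p : ∀ {j} → j ∈ range q → p < j + p
      p<j+p j∈ = m<n+m p (proj₁ (to ∈-range j∈))
      zζ-injective : ∀ {i j} → i ∈ range (p + q) → j ∈ range (p + q) → at z (at ζ i) ≡ at z (at ζ j) → i ≡ j
      zζ-injective i∈ j∈ = at-injective grassmannian-↭ i∈ j∈ ∘
        at-injective z↭ (at-∈-↭ grassmannian-↭ i∈) (at-∈-↭ grassmannian-↭ j∈)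

    leftMax-↭ : leftMax ↭ range p
    leftMax-↭ = st-map-range-↭ _ p λ i∈ j∈ → zζ-injective (L i∈) (L j∈)

    rightMax-↭ : rightMax ↭ range q
    rightMax-↭ = st-map-range-↭ _ q λ i∈ j∈ → +-cancelʳ-≡ p _ _ ∘ zζ-injective (R i∈) (R j∈)

    module _ {u v} (u↭ : u ↭ range p) (v↭ : v ↭ range q) where

      private
        ρ-left : ∀ {i} → i ∈ range p → at (ρ ζ u v) (at ζ i) ≡ at u i
        ρ-left i∈ = trans (at-ρ u↭ v↭ (L i∈)) (at-cross-left u↭ v↭ i∈)
        ρ-right : ∀ {j} → j ∈ range q → at (ρ ζ u v) (at ζ (j + p)) ≡ at v j + p
        ρ-right j∈ = trans (at-ρ u↭ v↭ (R j∈)) (at-cross-right u↭ v↭ j∈)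
        ζ∈range : ∀ {i} → i ∈ range (p + q) → at ζ i ∈ range (p + q)
        ζ∈range = at-∈-↭ grassmannian-↭

      ρ⊑⇒ : ρ ζ u v ⊑[ p + q ] z → InvertsCross × u ⊑[ p ] leftMax × v ⊑[ q ] rightMax
      ρ⊑⇒ ρ⊑z =
        (λ i j i∈ j∈ ζj<ζi → ρ⊑z _ _ (ζ∈range (R j∈)) (ζ∈range (L i∈)) ζj<ζi
          (subst₂ _<_ (sym (at-ρ u↭ v↭ (L i∈))) (sym (at-ρ u↭ v↭ (R j∈))) (cross-left<right u↭ v↭ i∈ j∈))) ,
        (λ i j i∈ j∈ i<j uj<ui → from (st-< _ p j∈ i∈) (ρ⊑z _ _ (ζ∈range (L i∈)) (ζ∈range (L j∈))
          (grassmannian-ascent (L i∈) (L j∈) i<j (inj₁ (i≤p j∈)))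
          (subst₂ _<_ (sym (ρ-left j∈)) (sym (ρ-left i∈)) uj<ui))) ,
        (λ i j i∈ j∈ i<j vj<vi → from (st-< _ q j∈ i∈) (ρ⊑z _ _ (ζ∈range (R i∈)) (ζ∈range (R j∈))
          (grassmannian-ascent (R i∈) (R j∈) (+-monoˡ-< p i<j) (inj₂ (p<j+p i∈)))
          (subst₂ _<_ (sym (ρ-right j∈)) (sym (ρ-right i∈)) (+-monoˡ-< p vj<vi))))

      -- Pairs inside one block reduce to u or v, as ζ keeps their order. A v-letter before a
      -- u-letter is covered by `InvertsCross`, and a u-letter before a v-letter is never inverted
      -- in ρ.
      ρ⊑⇐ : InvertsCross → u ⊑[ p ] leftMax → v ⊑[ q ] rightMax → ρ ζ u v ⊑[ p + q ] z
      ρ⊑⇐ inv u⊑ v⊑ x y x∈ y∈ x<y ρy<ρx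
        with a , a∈ , refl ← at-surjective grassmannian-↭ x∈
           | b , b∈ , refl ← at-surjective grassmannian-↭ y∈
        with range-split p a∈ | range-split p b∈
      ... | inj₁ a∈p              | inj₁ b∈p              = to (st-< _ p b∈p a∈p) (u⊑ a b a∈p b∈p
              (grassmannian-ascent⁻ a∈ b∈ x<y (inj₁ (i≤p a∈p , i≤p b∈p)))
              (subst₂ _<_ (ρ-left b∈p) (ρ-left a∈p) ρy<ρx))
      ... | inj₁ a∈p              | inj₂ (j , j∈ , refl)  = contradiction
              (subst₂ _<_ (at-ρ u↭ v↭ b∈) (at-ρ u↭ v↭ a∈) ρy<ρx) (<-asym (cross-left<right u↭ v↭ a∈p j∈))
      ... | inj₂ (i , i∈ , refl)  | inj₁ b∈p              = inv b i b∈p i∈ x<y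
      ... | inj₂ (i , i∈ , refl)  | inj₂ (j , j∈ , refl)  = to (st-< _ q j∈ i∈) (v⊑ i j i∈ j∈
              (+-cancelʳ-< p i j (grassmannian-ascent⁻ a∈ b∈ x<y (inj₂ (p<j+p i∈ , p<j+p j∈))))
              (+-cancelʳ-< p _ _ (subst₂ _<_ (ρ-right j∈) (ρ-right i∈) ρy<ρx)))

    -- A decidable stand-in for `InvertsCross`, usable as an indicator: a nonempty fibre contains
    -- the pair of its two maxima, so testing that pair suffices.
    nonempty : Bool
    nonempty = weakLeq (ρ ζ leftMax rightMax) z

    T-weakLeq-ρ : ∀ {u v} → u ↭ range p → v ↭ range q →
      T (weakLeq (ρ ζ u v) z) ⇔ (T nonempty × T (weakLeq u leftMax) × T (weakLeq v rightMax))
    T-weakLeq-ρ {u} {v} u↭ v↭ = mk⇔ forward backward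
      where
      max-↭ : ρ ζ leftMax rightMax ↭ range (p + q)
      max-↭ = ρ-↭ leftMax-↭ rightMax-↭
      nonempty⁺ : InvertsCross → T nonempty
      nonempty⁺ inv = ⊑⇒weakLeq {u = ρ ζ leftMax rightMax} {z} max-↭ z↭
        (ρ⊑⇐ leftMax-↭ rightMax-↭ inv (λ _ _ _ _ _ h → h) (λ _ _ _ _ _ h → h))
      nonempty⁻ : T nonempty → InvertsCross
      nonempty⁻ h = proj₁ (ρ⊑⇒ leftMax-↭ rightMax-↭ (weakLeq⇒⊑ {u = ρ ζ leftMax rightMax} {z} max-↭ z↭ h))
      forward : T (weakLeq (ρ ζ u v) z) → T nonempty × T (weakLeq u leftMax) × T (weakLeq v rightMax)
      forward h =
        let inv , u⊑ , v⊑ = ρ⊑⇒ u↭ v↭ (weakLeq⇒⊑ {u = ρ ζ u v} {z} (ρ-↭ u↭ v↭) z↭ h) in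
        nonempty⁺ inv , ⊑⇒weakLeq {u = u} {leftMax} u↭ leftMax-↭ u⊑ , ⊑⇒weakLeq {u = v} {rightMax} v↭ rightMax-↭ v⊑
      backward : T nonempty × T (weakLeq u leftMax) × T (weakLeq v rightMax) → T (weakLeq (ρ ζ u v) z)
      backward (h , u≤ , v≤) = ⊑⇒weakLeq {u = ρ ζ u v} {z} (ρ-↭ u↭ v↭) z↭
        (ρ⊑⇐ u↭ v↭ (nonempty⁻ h)
          (weakLeq⇒⊑ {u = u} {leftMax} u↭ leftMax-↭ u≤) (weakLeq⇒⊑ {u = v} {rightMax} v↭ rightMax-↭ v≤))

    -- Together with `isMaximal` this spells out the condition in `alpha`, so that the final count
    -- is `alpha` by definition.
    notAbove : Word → Word → Word → Word → Bool
    notAbove u v u′ v′ = not (weakLeq u u′ ∧ weakLeq v v′ ∧ weakLeq (ρ ζ u′ v′) z) ∨ (eqW u′ u ∧ eqW v′ v)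

    isMaximal : Word → Word → Bool
    isMaximal u v = weakLeq (ρ ζ u v) z ∧ allB (λ u′ → allB (notAbove u v u′) (perms q)) (perms p)

    T-notAbove : ∀ {u v u′ v′} → T (notAbove u v u′ v′) ⇔
      (T (weakLeq u u′) → T (weakLeq v v′) → T (weakLeq (ρ ζ u′ v′) z) → u′ ≡ u × v′ ≡ v)
    T-notAbove {u} {v} {u′} {v′} = mk⇔
      (λ h a b c → let u≡ , v≡ = to (T-∧ {eqW u′ u} {eqW v′ v}) (to (truth _ _ _ _) h a b c)
                   in to (T-eqW {u′} {u}) u≡ , to (T-eqW {v′} {v}) v≡)
      (λ f → from (truth (weakLeq u u′) (weakLeq v v′) (weakLeq (ρ ζ u′ v′) z) (eqW u′ u ∧ eqW v′ v)) λ a b c →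
        let u≡ , v≡ = f a b c in from (T-∧ {eqW u′ u} {eqW v′ v}) (from (T-eqW {u′} {u}) u≡ , from (T-eqW {v′} {v}) v≡))
      where
      truth : ∀ a b c d → T (not (a ∧ b ∧ c) ∨ d) ⇔ (T a → T b → T c → T d)
      truth true  true  true  d = mk⇔ (λ h _ _ _ → h) (λ f → f tt tt tt)
      truth true  true  false d = mk⇔ (λ _ _ _ ()) (λ _ → tt)
      truth true  false c     d = mk⇔ (λ _ _ ()) (λ _ → tt)
      truth false b     c     d = mk⇔ (λ _ ()) (λ _ → tt)

    -- A product of principal ideals has its maximum as sole maximal element. One direction tests
    -- maximality at the pair (`leftMax`, `rightMax`); the other uses that this pair bounds the
    -- whole fibre.
    isMaximal≡ : ∀ {u v} → u ↭ range p → v ↭ range q →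
      isMaximal u v ≡ nonempty ∧ (eqW u leftMax ∧ eqW v rightMax)
    isMaximal≡ {u} {v} u↭ v↭ = T-ext sound complete
      where
      sound : T (isMaximal u v) → T (nonempty ∧ (eqW u leftMax ∧ eqW v rightMax))
      sound h =
        let ρ≤z , max         = to (T-∧ {weakLeq (ρ ζ u v) z}) h
            ne , u≤ , v≤      = to (T-weakLeq-ρ {u} {v} u↭ v↭) ρ≤z
            max-at            = T-allB⁻ {p = notAbove u v leftMax}
                                  (T-allB⁻ {p = λ u′ → allB (notAbove u v u′) (perms q)} max (∈-perms⁺ leftMax-↭))
                                  (∈-perms⁺ rightMax-↭)
            left≡ , right≡    = to (T-notAbove {u} {v} {leftMax} {rightMax}) max-at u≤ v≤ ne
        in from (T-∧ {nonempty}) (ne , from (T-∧ {eqW u leftMax})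
             (from (T-eqW {u} {leftMax}) (sym left≡) , from (T-eqW {v} {rightMax}) (sym right≡)))
      complete : T (nonempty ∧ (eqW u leftMax ∧ eqW v rightMax)) → T (isMaximal u v)
      complete h = attains (to (T-eqW {u} {leftMax}) (proj₁ eqs)) (to (T-eqW {v} {rightMax}) (proj₂ eqs))
        where
        ne : T nonempty
        ne = proj₁ (to (T-∧ {nonempty}) h)
        eqs : T (eqW u leftMax) × T (eqW v rightMax)
        eqs = to (T-∧ {eqW u leftMax}) (proj₂ (to (T-∧ {nonempty}) h))
        attains : u ≡ leftMax → v ≡ rightMax → T (isMaximal u v)
        attains refl refl = from (T-∧ {nonempty}) (ne ,
          T-allB⁺ {p = λ u′ → allB (notAbove u v u′) (perms q)} λ {u′} u′∈ →
          T-allB⁺ {p = notAbove u v u′} λ {v′} v′∈ →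
          from (T-notAbove {u} {v} {u′} {v′}) λ u≤u′ v≤v′ ρ≤z →
            let u′↭             = ∈-perms⁻ {p} u′∈
                v′↭             = ∈-perms⁻ {q} v′∈
                _ , u′≤u , v′≤v = to (T-weakLeq-ρ {u′} {v′} u′↭ v′↭) ρ≤z
            in weakLeq-antisym u′↭ u↭ u′≤u u≤u′ , weakLeq-antisym v′↭ v↭ v′≤v v≤v′)

    -- The contribution of a single ζ: by `T-weakLeq-ρ` the indicator factors, and `∑-mobius` turns
    -- each factor into a delta at `leftMax` or `rightMax`.
    ∑-mobius-ρ : ∀ {u v} → u ↭ range p → v ↭ range q →
      ∑ (perms p) (λ u′ → ⟦ weakLeq u u′ ⟧ ℚ.* (mobius u u′ ℚ.*
        ∑ (perms q) (λ v′ → ⟦ weakLeq v v′ ⟧ ℚ.* (mobius v v′ ℚ.* ⟦ weakLeq (ρ ζ u′ v′) z ⟧))))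
      ≡ ⟦ isMaximal u v ⟧
    ∑-mobius-ρ {u} {v} u↭ v↭ = trans
      (∑-separate (perms p) (perms q) (⟦_⟧ ∘ weakLeq u) (mobius u) (⟦_⟧ ∘ weakLeq v) (mobius v)
        (λ u′ v′ → ⟦ weakLeq (ρ ζ u′ v′) z ⟧) ⟦ nonempty ⟧
        (λ u′ → ⟦ weakLeq u′ leftMax ⟧) (λ v′ → ⟦ weakLeq v′ rightMax ⟧)
        (λ u′∈ v′∈ → factor (∈-perms⁻ {p} u′∈) (∈-perms⁻ {q} v′∈))
        (∑-mobius u↭ leftMax-↭) (∑-mobius v↭ rightMax-↭))
      (trans (sym (⟦⟧-∧₃ nonempty (eqW u leftMax) (eqW v rightMax))) (cong ⟦_⟧ (sym (isMaximal≡ u↭ v↭))))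
      where
      ⟦⟧-∧₃ : ∀ a b c → ⟦ a ∧ (b ∧ c) ⟧ ≡ ⟦ a ⟧ ℚ.* (⟦ b ⟧ ℚ.* ⟦ c ⟧)
      ⟦⟧-∧₃ a b c = trans (⟦⟧-∧ a (b ∧ c)) (cong (⟦ a ⟧ ℚ.*_) (⟦⟧-∧ b c))
      T-∧₃ : ∀ {a b c} → T (a ∧ (b ∧ c)) ⇔ (T a × T b × T c)
      T-∧₃ {true}  {b} = mk⇔ (λ h → tt , to (T-∧ {b}) h) (λ (_ , h) → from (T-∧ {b}) h)
      T-∧₃ {false} {b} = mk⇔ (λ ()) proj₁
      factor : ∀ {u′ v′} → u′ ↭ range p → v′ ↭ range q → ⟦ weakLeq (ρ ζ u′ v′) z ⟧ ≡
               ⟦ nonempty ⟧ ℚ.* (⟦ weakLeq u′ leftMax ⟧ ℚ.* ⟦ weakLeq v′ rightMax ⟧)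
      factor {u′} {v′} u′↭ v′↭ = trans
        (cong ⟦_⟧ (T-ext {weakLeq (ρ ζ u′ v′) z} {nonempty ∧ (weakLeq u′ leftMax ∧ weakLeq v′ rightMax)}
          (λ h → from (T-∧₃ {nonempty} {weakLeq u′ leftMax}) (to (T-weakLeq-ρ {u′} {v′} u′↭ v′↭) h))
          (λ h → from (T-weakLeq-ρ {u′} {v′} u′↭ v′↭) (to (T-∧₃ {nonempty} {weakLeq u′ leftMax}) h))))
        (⟦⟧-∧₃ nonempty (weakLeq u′ leftMax) (weakLeq v′ rightMax))

-- Degrees of the two sides and the product formula

Homogeneous-sumS : ∀ {n xs} → (∀ {x} → x ∈ xs → Homogeneous n x) → Homogeneous n (sumS xs)
Homogeneous-sumS {xs = xs} hom ay∈ = let x , ay∈x , x∈ = ∈-concat⁻′ xs ay∈ in hom x∈ ay∈x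

Homogeneous-• : ∀ {n} c {x} → Homogeneous n x → Homogeneous n (c • x)
Homogeneous-• c hx cay∈ with (_ , _) , ay∈ , refl ← ∈-map⁻ _ cay∈ = hx ay∈

Homogeneous-M : ∀ {n u} → u ↭ range n → Homogeneous n (M u)
Homogeneous-M {n} u↭ ay∈ with y , y∈ , refl ← ∈-map⁻ _ ay∈ =
  ∈-perms⁻ (subst (λ k → y ∈ perms k) (↭range⇒length u↭) (proj₁ (∈-filterB⁻ y∈)))

Homogeneous-· : ∀ {p q x y} → Homogeneous p x → Homogeneous q y → Homogeneous (p + q) (x · y)
Homogeneous-· {p} {q} {x} {y} hx hy = Homogeneous-sumS terms
  where
  prodF-homogeneous : ∀ {u v} → u ↭ range p → v ↭ range q → Homogeneous (p + q) (prodF u v)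
  prodF-homogeneous u↭ v↭ aw∈ with ζ , ζ∈ , refl ← ∈-map⁻ _ aw∈ =
    ρ-↭ (subst₂ (λ k l → ζ ∈ grassmannian k l) (↭range⇒length u↭) (↭range⇒length v↭) ζ∈) u↭ v↭
  row : ℚ × Word → List SSym
  row (a , u) = map (λ (b , v) → (a ℚ.* b) • prodF u v) y
  terms : ∀ {s} → s ∈ concatMap row x → Homogeneous (p + q) s
  terms s∈ with (a , u) , au∈ , s∈row ← find (∈-concatMap⁻ row {xs = x} s∈)
           with (b , v) , bv∈ , refl ← ∈-map⁻ (λ (b , v) → (a ℚ.* b) • prodF u v) s∈row =
    Homogeneous-• (a ℚ.* b) (prodF-homogeneous (hx au∈) (hy bv∈))

theorem2p2 : (p q : ℕ) (u v : Word) → IsPerm p u → IsPerm q v →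
    (M u · M v) ≈ sumS (map (λ w → ℕtoℚ (alpha u v w) • M w) (perms (p + q)))
-- Matching on `refl` makes p and q the lengths of u and v, from which `alpha` computes its own
-- block sizes.
theorem2p2 _ _ u v u-perm@(refl , _) v-perm@(refl , _) = ≈-from-ideals {y = expansion}
  (Homogeneous-· (Homogeneous-M u↭) (Homogeneous-M v↭))
  (Homogeneous-sumS {xs = map term (perms (p + q))} λ s∈ →
    case ∈-map⁻ term s∈ of λ { (w , w∈ , refl) → Homogeneous-• (ℕtoℚ (alpha u v w)) (Homogeneous-M (∈-perms⁻ w∈)) })
  (λ z↭ → trans (lhs z↭) (sym (rhs z↭)))
  where
  open ≡-Reasoning
  p = length u
  q = length v
  term : Word → SSym
  term w = ℕtoℚ (alpha u v w) • M w
  expansion : SSym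
  expansion = sumS (map term (perms (p + q)))
  u↭ : u ↭ range p
  u↭ = IsPerm⇒↭ u-perm
  v↭ : v ↭ range q
  v↭ = IsPerm⇒↭ v-perm
  below-sum : Word → SSym → ℚ
  below-sum z = eval (λ y → ⟦ weakLeq y z ⟧)

  ∑-pull : ∀ {A B : Set} (xs : List A) (zs : List B) (a m : A → ℚ) (h : A → B → ℚ) →
    ∑ xs (λ x → a x ℚ.* (m x ℚ.* ∑ zs (h x))) ≡ ∑ zs (λ z → ∑ xs (λ x → a x ℚ.* (m x ℚ.* h x z)))
  ∑-pull xs zs a m h = trans
    (∑-cong xs λ {x} _ → trans (cong (a x ℚ.*_) (sym (∑-*ˡ (m x) zs (h x)))) (sym (∑-*ˡ (a x) zs _)))
    (∑-swap xs zs _)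

  lhs : ∀ {z} → z ↭ range (p + q) → below-sum z (M u · M v) ≡ ℕtoℚ (alpha u v z)
  lhs {z} z↭ = begin
    below-sum z (M u · M v)
      ≡⟨ eval-· _ (M u) (M v) ⟩
    _
      ≡⟨ eval-M _ u ⟩
    ∑ (perms p) (λ u′ → ⟦ weakLeq u u′ ⟧ ℚ.* (mobius u u′ ℚ.* eval (λ v′ →
      ∑ (grassmannian (length u′) (length v′)) (λ ζ → X ζ u′ v′)) (M v)))
      ≡⟨ ∑-cong (perms p) (λ {u′} u′∈ → cong (λ s → ⟦ weakLeq u u′ ⟧ ℚ.* (mobius u u′ ℚ.* s)) (begin
           _ ≡⟨ eval-M _ v ⟩
           -- The Grassmannian index set must first be freed from u′ and v′, through their lengths,
           -- before the sum over ζ can move outside.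
           _ ≡⟨ ∑-cong (perms q) (λ {v′} v′∈ → cong₂ (λ p q → ⟦ weakLeq v v′ ⟧ ℚ.* (mobius v v′ ℚ.*
                  ∑ (grassmannian p q) (λ ζ → X ζ u′ v′)))
                    (↭range⇒length (∈-perms⁻ {p} u′∈)) (↭range⇒length (∈-perms⁻ {q} v′∈))) ⟩
           _ ≡⟨ ∑-pull (perms q) (grassmannian p q) (⟦_⟧ ∘ weakLeq v) (mobius v) (λ v′ ζ → X ζ u′ v′) ⟩
           _ ∎)) ⟩
    _ ≡⟨ ∑-pull (perms p) (grassmannian p q) (⟦_⟧ ∘ weakLeq u) (mobius u)
          (λ u′ ζ → ∑ (perms q) (λ v′ → ⟦ weakLeq v v′ ⟧ ℚ.* (mobius v v′ ℚ.* X ζ u′ v′))) ⟩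
    ∑ (grassmannian p q) (λ ζ → ∑ (perms p) (λ u′ → ⟦ weakLeq u u′ ⟧ ℚ.* (mobius u u′ ℚ.*
      ∑ (perms q) (λ v′ → ⟦ weakLeq v v′ ⟧ ℚ.* (mobius v v′ ℚ.* X ζ u′ v′)))))
      ≡⟨ ∑-cong (grassmannian p q) (λ ζ∈ → ∑-mobius-ρ ζ∈ z↭ u↭ v↭) ⟩
    _
      ≡⟨ ∑-countB _ (grassmannian p q) ⟩
    ℕtoℚ (alpha u v z) ∎
    where
    X : Word → Word → Word → ℚ
    X ζ u′ v′ = ⟦ weakLeq (ρ ζ u′ v′) z ⟧

  rhs : ∀ {z} → z ↭ range (p + q) → below-sum z expansion ≡ ℕtoℚ (alpha u v z)
  rhs {z} z↭ = begin
    _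
      ≡⟨ eval-sumS _ (map term (perms (p + q))) ⟩
    _
      ≡⟨ ∑-map term (perms (p + q)) _ ⟩
    ∑ (perms (p + q)) (λ w → below-sum z (term w))
      ≡⟨ ∑-cong (perms (p + q)) (λ {w} w∈ → begin
           _ ≡⟨ eval-• _ (ℕtoℚ (alpha u v w)) (M w) ⟩
           ℕtoℚ (alpha u v w) ℚ.* below-sum z (M w)
             ≡⟨ cong (ℕtoℚ (alpha u v w) ℚ.*_) (below-sum-M (∈-perms⁻ w∈)) ⟩
           ℕtoℚ (alpha u v w) ℚ.* ⟦ eqW w z ⟧
             ≡⟨ ℚ.*-comm (ℕtoℚ (alpha u v w)) _ ⟩
           ⟦ eqW w z ⟧ ℚ.* ℕtoℚ (alpha u v w)
             ≡⟨ cong (λ b → ⟦ b ⟧ ℚ.* ℕtoℚ (alpha u v w)) (eqW-sym w z) ⟩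
           ⟦ eqW z w ⟧ ℚ.* ℕtoℚ (alpha u v w) ∎) ⟩
    ∑ (perms (p + q)) (λ w → ⟦ eqW z w ⟧ ℚ.* ℕtoℚ (alpha u v w))
      ≡⟨ ∑-eqW (Unique-perms (p + q)) (∈-perms⁺ z↭) (λ w → ℕtoℚ (alpha u v w)) ⟩
    ℕtoℚ (alpha u v z) ∎
    where
    below-sum-M : ∀ {w} → w ↭ range (p + q) → below-sum z (M w) ≡ ⟦ eqW w z ⟧
    below-sum-M {w} w↭ = trans (eval-M _ w) (trans
      (cong (λ k → ∑ (perms k) (λ y → ⟦ weakLeq w y ⟧ ℚ.* (mobius w y ℚ.* ⟦ weakLeq y z ⟧))) (↭range⇒length w↭))
      (∑-mobius w↭ z↭))
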